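{- Let $r\ge1$ and let $b_1\ge\cdots\ge b_r$ be integers with $b_i\ge i$ for all $i$. Let $\widehat F_{\mathbf b}=F_{\mathbf b}\sqcup\{\widehat0\}$ be the Ferrers-cell poset with a new minimum $\widehat0$ adjoined, with rank $\widehat\rho(\widehat0)=0$ and $\widehat\rho(i,c)=c-i+1$, and let $$X_{\widehat F_{\mathbf b}}(y)=\sum_{x\in\widehat F_{\mathbf b}}\mu(\widehat0,x)\,y^{\,b_1-\widehat\rho(x)}$$ be its characteristic polynomial, where $\mu$ is the Möbius function of $\widehat F_{\mathbf b}$. Then $$X_{\widehat F_{\mathbf b}}(y)=y^{b_1}-r\,y^{b_1-1}+(r-1)\,y^{b_1-2},$$ where the last term is understood to be absent when $r=1$. Thus the characteristic polynomial is independent of $b_2,\dots,b_r$. In particular, for the balanced boundary $b_i=2r-i$ and $r\ge2$, writing $\widehat C_r$ for the corresponding lattice $\widehat F_{\mathbf b}$ (the minimum-augmented positive-root poset of type $B_r$, equivalently of type $C_r$), $$X_{\widehat C_r}(y)=y^{2r-3}(y-1)\bigl(y-(r-1)\bigr).$$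
   Context: Ferrers-cell poset: $F_{\mathbf b}=\{(i,c):1\le i\le r,\ i\le c\le b_i\}$, ordered by $(i,c)\le(j,d)\iff i\ge j$ and $c\le d$. In $\widehat F_{\mathbf b}$ the element $\widehat0$ lies below every cell. -}

module Defs where

open import Data.Bool.Base using (if_then_else_)
open import Data.Fin.Base as Fin using (Fin; toℕ; fromℕ<)
import Data.Fin.Properties as Fin
open import Data.Integer.Base as ℤ using (ℤ; 0ℤ; 1ℤ)
import Data.Integer.Properties as ℤ
open import Data.List.Base using (List; []; _∷_; map; foldr; concatMap; allFin)
open import Data.List.Properties using (map-cong)
open import Data.List.Membership.Propositional using (_∈_)
open import Data.List.Membership.Propositional.Properties using (∈-allFin; ∈-concatMap⁺; ∈-map⁺; ∈-map⁻)
import Data.List.Relation.Unary.All as All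
import Data.List.Relation.Unary.All.Properties as All
import Data.List.Relation.Unary.AllPairs as AllPairs
import Data.List.Relation.Unary.AllPairs.Properties as AllPairs
open import Data.List.Relation.Unary.Any as Any using (here; there)
open import Data.List.Relation.Unary.Unique.Propositional using (Unique)
import Data.List.Relation.Unary.Unique.Propositional.Properties as Unique
open import Data.Nat.Base as ℕ using (ℕ; zero; suc; _∸_)
open import Data.Nat.Induction using () renaming (<-wellFounded to ℕ-<-wellFounded)
import Data.Nat.Properties as ℕ
open import Data.Product.Base using (_×_; _,_; Σ-syntax)
open import Data.Vec.Functional using (Vector)
open import Function.Base using (_∘_)
open import Induction.WellFounded using (WellFounded; Acc; acc; module Subrelation)
open import Level using (0ℓ)
open import Relation.Binary.Core using (Rel)
open import Relation.Binary.Construct.Add.Infimum.NonStrict as AddInfimum using (⊥₋≤_; [_])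
import Relation.Binary.Construct.NonStrictToStrict as ToStrict
import Relation.Binary.Construct.On as On
open import Relation.Binary.PropositionalEquality
open import Relation.Binary.Structures using (IsDecPartialOrder)
open import Relation.Nullary using (Dec; yes; no; contradiction)
open import Relation.Nullary.Construct.Add.Infimum using (_₋; ⊥₋; [_]; []-injective)
open import Relation.Nullary.Decidable using (⌊_⌋; map′; recompute; _×-dec_)
open import Algebra.Properties.Monoid.Sum ℤ.+-0-monoid using () renaming (sum to ∑)

infixl 6 _+ₚ_ _-ₚ_
infixl 7 _*ₚ_
infixr 8 _^ₚ_
infix  4 _≈ₚ_

-- The polynomial ring ℤ[y].  A polynomial is a list of coefficients, constant
-- term first; trailing zeros are allowed, so equality is _≈ₚ_ and not _≡_.

Polynomial : Set
Polynomial = List ℤ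

coeff : Polynomial → ℕ → ℤ
coeff []      _       = 0ℤ
coeff (a ∷ _) zero    = a
coeff (_ ∷ p) (suc n) = coeff p n

_≈ₚ_ : Rel Polynomial 0ℓ
p ≈ₚ q = ∀ n → coeff p n ≡ coeff q n

_+ₚ_ : Polynomial → Polynomial → Polynomial
[]      +ₚ q       = q
(a ∷ p) +ₚ []      = a ∷ p
(a ∷ p) +ₚ (b ∷ q) = a ℤ.+ b ∷ (p +ₚ q)

_-ₚ_ : Polynomial → Polynomial → Polynomial
p -ₚ q = p +ₚ map ℤ.-_ q

_*ₚ_ : Polynomial → Polynomial → Polynomial
[]      *ₚ q = []
(a ∷ p) *ₚ q = map (a ℤ.*_) q +ₚ (0ℤ ∷ p *ₚ q)

const : ℤ → Polynomial
const a = a ∷ []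

y : Polynomial
y = 0ℤ ∷ 1ℤ ∷ []

_^ₚ_ : Polynomial → ℕ → Polynomial
p ^ₚ zero  = const 1ℤ
p ^ₚ suc n = p *ₚ p ^ₚ n

-- Well-foundedness of _<_ holds in every finite poset; it is a field only so
-- that instances can obtain it from a rank function.

record FinitePoset : Set₁ where
  infix 4 _≤_
  field
    Carrier           : Set
    _≤_               : Rel Carrier 0ℓ
    isDecPartialOrder : IsDecPartialOrder _≡_ _≤_

  open IsDecPartialOrder isDecPartialOrder public
    using (_≟_; _≤?_; isPartialOrder)
  open ToStrict _≡_ _≤_ public using (_<_)

  field
    <-wellFounded     : WellFounded _<_
    elements          : List Carrier
    elements-complete : ∀ x → x ∈ elements
    elements-unique   : Unique elements

  _<?_ : ∀ x z → Dec (x < z)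
  _<?_ = ToStrict.<-decidable _≡_ _≤_ _≟_ _≤?_

module _ (P : FinitePoset) where
  open FinitePoset P

  private
    Σℤ : List ℤ → ℤ
    Σℤ = foldr ℤ._+_ 0ℤ

  -- μ(x,x) = 1 and μ(x,z) = - Σ_{x ≤ w < z} μ(x,w) for x ≠ z; in particular
  -- μ(x,z) = 0 when x ≰ z, the sum then being empty.

  mutual
    μ-acc : Carrier → ∀ z → Acc _<_ z → ℤ
    μ-acc x z a with x ≟ z
    ... | yes _ = 1ℤ
    ... | no  _ = ℤ.- Σℤ (map (μ-below x z a) elements)

    μ-below : Carrier → ∀ z → Acc _<_ z → Carrier → ℤ
    μ-below x z (acc rs) w with x ≤? w ×-dec w <? z
    ... | yes (_ , w<z) = μ-acc x w (rs w<z)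
    ... | no  _         = 0ℤ

  μ : Carrier → Carrier → ℤ
  μ x z = μ-acc x z (<-wellFounded z)

  mutual
    μ-acc-irrelevant : ∀ x z (a a′ : Acc _<_ z) → μ-acc x z a ≡ μ-acc x z a′
    μ-acc-irrelevant x z a a′ with x ≟ z
    ... | yes _ = refl
    ... | no  _ = cong (ℤ.-_ ∘ Σℤ) (map-cong (μ-below-irrelevant x z a a′) elements)

    μ-below-irrelevant : ∀ x z (a a′ : Acc _<_ z) w → μ-below x z a w ≡ μ-below x z a′ w
    μ-below-irrelevant x z (acc rs) (acc rs′) w with x ≤? w ×-dec w <? z
    ... | yes (_ , w<z) = μ-acc-irrelevant x w (rs w<z) (rs′ w<z)
    ... | no  _         = refl

  μ-refl : ∀ x → μ x x ≡ 1ℤ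
  μ-refl x with x ≟ x
  ... | yes _  = refl
  ... | no x≢x = contradiction refl x≢x

  μ-rec : ∀ {x z} → x ≢ z →
          μ x z ≡ ℤ.- Σℤ (map (λ w → if ⌊ x ≤? w ×-dec w <? z ⌋ then μ x w else 0ℤ) elements)
  μ-rec {x} {z} x≢z with x ≟ z
  ... | yes x≡z = contradiction x≡z x≢z
  ... | no  _   = cong (ℤ.-_ ∘ Σℤ) (map-cong (unfold (<-wellFounded z)) elements)
    where
    unfold : ∀ (a : Acc _<_ z) w →
             μ-below x z a w ≡ (if ⌊ x ≤? w ×-dec w <? z ⌋ then μ x w else 0ℤ)
    unfold (acc rs) w with x ≤? w ×-dec w <? z
    ... | yes (_ , w<z) = μ-acc-irrelevant x w (rs w<z) (<-wellFounded w)
    ... | no  _         = refl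

  characteristicPolynomial : Carrier → (Carrier → ℕ) → ℕ → Polynomial
  characteristicPolynomial 0̂ ρ n =
    foldr _+ₚ_ [] (map (λ x → const (μ 0̂ x) *ₚ y ^ₚ (n ∸ ρ x)) elements)

-- Rows 1, …, r are indexed by Fin r, so that  pos i  is the mathematical index.

pos : ∀ {r} → Fin r → ℕ
pos i = suc (toℕ i)

record Cell {r} (b : Vector ℕ r) : Set where
  constructor cell
  field
    row      : Fin r
    col      : ℕ
    .row≤col : pos row ℕ.≤ col
    .col≤b   : col ℕ.≤ b row

module _ {r} {b : Vector ℕ r} where
  open Cell

  infix 4 _≤ᶠ_ _<ᶠ_

  _≤ᶠ_ : Rel (Cell b) 0ℓ
  u ≤ᶠ v = pos (row v) ℕ.≤ pos (row u) × col u ℕ.≤ col v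

  Cell-≡ : {u v : Cell b} → row u ≡ row v → col u ≡ col v → u ≡ v
  Cell-≡ refl refl = refl

  ≤ᶠ-isDecPartialOrder : IsDecPartialOrder _≡_ _≤ᶠ_
  ≤ᶠ-isDecPartialOrder = record
    { isPartialOrder = record
      { isPreorder = record
        { isEquivalence = isEquivalence
        ; reflexive     = λ { refl → ℕ.≤-refl , ℕ.≤-refl }
        ; trans         = λ (p , q) (p′ , q′) → ℕ.≤-trans p′ p , ℕ.≤-trans q q′
        }
      ; antisym = λ (p , q) (p′ , q′) →
          Cell-≡ (Fin.toℕ-injective (ℕ.suc-injective (ℕ.≤-antisym p′ p))) (ℕ.≤-antisym q q′)
      }
    ; _≟_  = λ u v → map′ (λ (p , q) → Cell-≡ p q) (λ { refl → refl , refl })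
                          (row u Fin.≟ row v ×-dec col u ℕ.≟ col v)
    ; _≤?_ = λ u v → pos (row v) ℕ.≤? pos (row u) ×-dec col u ℕ.≤? col v
    }

  -- The subtraction never truncates, since  pos (row u) ≤ col u.
  ρ̂ : Cell b ₋ → ℕ
  ρ̂ ⊥₋    = 0
  ρ̂ [ u ] = suc (col u ∸ pos (row u))

  open AddInfimum _≤ᶠ_ public using () renaming (_≤₋_ to _≤̂_)

  _<ᶠ_ : Rel (Cell b ₋) 0ℓ
  _<ᶠ_ = ToStrict._<_ _≡_ _≤̂_

  ρ̂-mono-< : ∀ {u v : Cell b ₋} → u <ᶠ v → ρ̂ u ℕ.< ρ̂ v
  ρ̂-mono-< {⊥₋}    {⊥₋}    (_ , u≢v) = contradiction refl u≢v
  ρ̂-mono-< {⊥₋}    {[ v ]} _         = ℕ.z<s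
  ρ̂-mono-< {[ cell i c i≤c _ ]} {[ cell j d j≤d _ ]} ([ j≤i , c≤d ] , u≢v) =
    ℕ.s<s (ℕ.≤∧≢⇒< (ℕ.∸-mono c≤d j≤i) λ eq → u≢v (cong [_] (Cell-≡ (row-≡ eq) (col-≡ eq))))
    where
    i≤c′ = recompute (pos i ℕ.≤? c) i≤c
    j≤d′ = recompute (pos j ℕ.≤? d) j≤d

    sum-≡ : c ∸ pos i ≡ d ∸ pos j → c ℕ.+ pos j ≡ d ℕ.+ pos i
    sum-≡ eq = begin
      c ℕ.+ pos j                     ≡⟨ cong (ℕ._+ pos j) (ℕ.m∸n+n≡m i≤c′) ⟨
      c ∸ pos i ℕ.+ pos i ℕ.+ pos j   ≡⟨ cong (λ k → k ℕ.+ pos i ℕ.+ pos j) eq ⟩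
      d ∸ pos j ℕ.+ pos i ℕ.+ pos j   ≡⟨ ℕ.+-assoc (d ∸ pos j) (pos i) (pos j) ⟩
      d ∸ pos j ℕ.+ (pos i ℕ.+ pos j) ≡⟨ cong (d ∸ pos j ℕ.+_) (ℕ.+-comm (pos i) (pos j)) ⟩
      d ∸ pos j ℕ.+ (pos j ℕ.+ pos i) ≡⟨ ℕ.+-assoc (d ∸ pos j) (pos j) (pos i) ⟨
      d ∸ pos j ℕ.+ pos j ℕ.+ pos i   ≡⟨ cong (ℕ._+ pos i) (ℕ.m∸n+n≡m j≤d′) ⟩
      d ℕ.+ pos i                     ∎
      where open ≡-Reasoning

    col-≡ : c ∸ pos i ≡ d ∸ pos j → c ≡ d
    col-≡ eq = ℕ.≤-antisym c≤d (ℕ.+-cancelʳ-≤ (pos i) d c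
      (subst (ℕ._≤ c ℕ.+ pos i) (sum-≡ eq) (ℕ.+-monoʳ-≤ c j≤i)))

    row-≡ : c ∸ pos i ≡ d ∸ pos j → i ≡ j
    row-≡ eq = Fin.toℕ-injective (ℕ.suc-injective (sym (ℕ.+-cancelˡ-≡ c (pos j) (pos i)
      (trans (sum-≡ eq) (cong (ℕ._+ pos i) (sym (col-≡ eq)))))))

module _ {r} (b : Vector ℕ r) where
  open Cell

  -- Row i consists of the columns  pos i + k  with  0 ≤ k < b i - (pos i - 1).
  rowCell : ∀ i → Fin (b i ∸ toℕ i) → Cell b
  rowCell i k = cell i (pos i ℕ.+ toℕ k) (ℕ.m≤m+n (pos i) (toℕ k)) bound
    where
    bound : pos i ℕ.+ toℕ k ℕ.≤ b i
    bound = ℕ.≤-trans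
      (ℕ.≤-reflexive (sym (ℕ.+-suc (toℕ i) (toℕ k))))
      (ℕ.≤-trans (ℕ.+-monoʳ-≤ (toℕ i) (Fin.toℕ<n k))
        (ℕ.≤-reflexive (ℕ.m+[n∸m]≡n {toℕ i} (ℕ.<⇒≤ (ℕ.m∸n≢0⇒n<m {b i} (nonZero k))))))
      where
      nonZero : ∀ {n} → Fin n → n ≢ 0
      nonZero () refl

  rowCells : Fin r → List (Cell b)
  rowCells i = map (rowCell i) (allFin (b i ∸ toℕ i))

  cells : List (Cell b)
  cells = concatMap rowCells (allFin r)

  cells-complete : ∀ u → u ∈ cells
  cells-complete (cell i c i≤c c≤b) =
    ∈-concatMap⁺ rowCells (Any.map (λ { refl → u∈row }) (∈-allFin i))
    where
    i≤c′ = recompute (pos i ℕ.≤? c) i≤c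

    k<len : c ∸ pos i ℕ.< b i ∸ toℕ i
    k<len = ℕ.m+n≤o⇒m≤o∸n (suc (c ∸ pos i))
      (ℕ.≤-trans (ℕ.≤-reflexive
        (trans (sym (ℕ.+-suc (c ∸ pos i) (toℕ i))) (ℕ.m∸n+n≡m i≤c′)))
        (recompute (c ℕ.≤? b i) c≤b))

    k = fromℕ< k<len

    col-≡ : pos i ℕ.+ toℕ k ≡ c
    col-≡ = trans (cong (pos i ℕ.+_) (Fin.toℕ-fromℕ< k<len)) (ℕ.m+[n∸m]≡n i≤c′)

    u∈row : cell i c i≤c c≤b ∈ rowCells i
    u∈row = subst (_∈ rowCells i) (Cell-≡ refl col-≡) (∈-map⁺ (rowCell i) (∈-allFin k))

  cells-unique : Unique cells
  cells-unique = Unique.concat⁺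
    (All.map⁺ (All.universal rowUnique (allFin r)))
    (AllPairs.map⁺ (AllPairs.map disjoint (Unique.allFin⁺ r)))
    where
    rowCell-injective : ∀ i {k l} → rowCell i k ≡ rowCell i l → k ≡ l
    rowCell-injective i eq = Fin.toℕ-injective (ℕ.+-cancelˡ-≡ (pos i) _ _ (cong col eq))

    rowUnique : ∀ i → Unique (rowCells i)
    rowUnique i = Unique.map⁺ (rowCell-injective i) (Unique.allFin⁺ (b i ∸ toℕ i))

    row-∈ : ∀ {i u} → u ∈ rowCells i → row u ≡ i
    row-∈ u∈ with _ , _ , refl ← ∈-map⁻ (rowCell _) u∈ = refl

    disjoint : ∀ {i j} → i ≢ j → ∀ {u} → u ∈ rowCells i × u ∈ rowCells j → _
    disjoint i≢j (u∈i , u∈j) = i≢j (trans (sym (row-∈ u∈i)) (row-∈ u∈j))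

  F̂ : FinitePoset
  F̂ = record
    { Carrier           = Cell b ₋
    ; _≤_               = _≤̂_
    ; isDecPartialOrder = AddInfimum.≤₋-isDecPartialOrder-≡ _≤ᶠ_ ≤ᶠ-isDecPartialOrder
    ; <-wellFounded     = Subrelation.wellFounded ρ̂-mono-<
                            (On.wellFounded ρ̂ ℕ-<-wellFounded)
    ; elements          = ⊥₋ ∷ map [_] cells
    ; elements-complete = λ { ⊥₋    → here refl
                            ; [ u ] → there (∈-map⁺ [_] (cells-complete u)) }
    ; elements-unique   = All.map⁺ (All.universal {P = λ u → ⊥₋ ≢ [ u ]} (λ _ ()) cells)
                            AllPairs.∷ Unique.map⁺ []-injective cells-unique
    }

b₁ : ∀ {m} → Vector ℕ (suc m) → ℕ
b₁ b = b Fin.zero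

-- When b is weakly decreasing, ρ̂ is bounded by b₁, so the subtraction in the
-- exponents does not truncate.
X : ∀ {m} → Vector ℕ (suc m) → Polynomial
X b = characteristicPolynomial (F̂ b) ⊥₋ ρ̂ (b₁ b)

balanced : ∀ r → Vector ℕ r
balanced r i = 2 ℕ.* r ∸ pos i

Ĉ : ℕ → FinitePoset
Ĉ r = F̂ (balanced r)

-- The root systems of types B_r and C_r in ℤ^r, with the standard basis ε.

data RootType : Set where
  B C : RootType

scale : RootType → ℤ
scale B = 1ℤ
scale C = ℤ.+ 2

ε : ∀ {r} → Fin r → Vector ℤ r
ε i k = if ⌊ i Fin.≟ k ⌋ then 1ℤ else 0ℤ

data PositiveRoot (r : ℕ) : Set where
  ε-ε  : (i j : Fin r) → .(i Fin.< j) → PositiveRoot r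
  ε+ε  : (i j : Fin r) → .(i Fin.< j) → PositiveRoot r
  axis : Fin r → PositiveRoot r

-- axis i  stands for ε_i in type B and for 2ε_i in type C.
toVector : ∀ {r} → RootType → PositiveRoot r → Vector ℤ r
toVector T (ε-ε i j _) k = ε i k ℤ.- ε j k
toVector T (ε+ε i j _) k = ε i k ℤ.+ ε j k
toVector T (axis i)    k = scale T ℤ.* ε i k

-- The simple roots: ε_i - ε_{i+1} for i < r, and the root on the last axis.
simple : ∀ {r} → Fin r → PositiveRoot r
simple {suc zero}    Fin.zero    = axis Fin.zero
simple {suc (suc r)} Fin.zero    = ε-ε Fin.zero (Fin.suc Fin.zero) ℕ.z<s
simple {suc (suc r)} (Fin.suc i) = shift (simple i)
  where
  shift : PositiveRoot (suc r) → PositiveRoot (suc (suc r))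
  shift (ε-ε i j i<j) = ε-ε (Fin.suc i) (Fin.suc j) (ℕ.s<s i<j)
  shift (ε+ε i j i<j) = ε+ε (Fin.suc i) (Fin.suc j) (ℕ.s<s i<j)
  shift (axis i)      = axis (Fin.suc i)

-- α ≤ β  iff  β - α  is a nonnegative integer combination of simple roots.
RootOrder : RootType → ∀ r → Rel (PositiveRoot r) 0ℓ
RootOrder T r α β = Σ[ n ∈ (Fin r → ℕ) ] ∀ k →
  toVector T β k ≡ toVector T α k ℤ.+ ∑ (λ i → ℤ.+ (n i) ℤ.* toVector T (simple i) k)

AugmentedRootOrder : RootType → ∀ r → Rel (PositiveRoot r ₋) 0ℓ
AugmentedRootOrder T r = AddInfimum._≤₋_ (RootOrder T r)

{-# OPTIONS --safe #-}

-- In F̂ the atoms are the cells (i,i), a cell (i,i+1) with i < r covers exactly two of them, and the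
-- ideal below a cell (i,c) with c > i contains one more atom than it has cells (j,j+1) with j < r.
-- So μ(0̂,-) is 1 at 0̂, -1 at the r atoms, 1 at the r - 1 cells (i,i+1) with i < r, and 0 elsewhere.
--
-- For the balanced boundary, a root is determined by the partial sums of its coordinates, and these
-- are increasing in the column and decreasing in the row of the corresponding cell.

module Submission where

open import Defs
open import Data.Bool.Base using (Bool; true; false; if_then_else_; _∧_)
open import Data.Fin.Base as Fin using (Fin; toℕ; fromℕ<)
import Data.Fin.Properties as Fin
open import Data.Integer.Base as ℤ using (ℤ; 0ℤ; 1ℤ; -1ℤ)
import Data.Integer.Properties as ℤ
open import Data.Integer.Tactic.RingSolver using (solve-∀)
open import Data.List.Base using (List; []; _∷_; _++_; map; foldr; concatMap; allFin; tabulate)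
open import Data.List.Membership.Propositional using (_∈_)
open import Data.List.Properties using (map-cong; map-++; map-∘; map-tabulate)
import Data.List.Relation.Unary.All as All
import Data.List.Relation.Unary.AllPairs as AllPairs
open import Data.List.Relation.Unary.Any using (here; there)
open import Data.List.Relation.Unary.Unique.Propositional using (Unique)
open import Data.Nat.Base as ℕ using (ℕ; zero; suc; _+_; _*_; _∸_; _≤_; _<_; _<ᵇ_; _⊔_; _⊓_; z≤n; s≤s)
import Data.Nat.Properties as ℕ
open import Data.Product.Base using (_×_; _,_; proj₁; proj₂; ∃; ∃₂)
open import Data.Sum.Base using (inj₁; inj₂)
open import Data.Vec.Functional as Vector using (Vector)
open import Function.Base using (_∘_)
open import Induction.WellFounded using (Acc; acc)
open import Relation.Binary.Construct.Add.Infimum.NonStrict using (⊥₋≤_; [_])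
open import Relation.Binary.Definitions using (tri<; tri≈; tri>)
open import Relation.Binary.Lattice.Structures using (IsLattice)
open import Relation.Binary.Morphism.Structures using (IsOrderIsomorphism)
open import Relation.Binary.PropositionalEquality hiding (isPartialOrder)
open import Relation.Binary.Structures using (IsPartialOrder)
open import Relation.Nullary using (Dec; yes; no; contradiction; ¬_)
open import Relation.Nullary.Construct.Add.Infimum using (_₋; ⊥₋; [_])
open import Relation.Nullary.Decidable using (⌊_⌋; isYes≗does; recompute; _×-dec_)
open import Algebra.Properties.CommutativeMonoid.Sum ℤ.+-0-commutativeMonoid
  using (sum-cong-≗; sum-replicate-zero) renaming (sum to ∑)

-- Finite sums and unit steps

-- The Möbius recursion is never run: the values are guessed, and a function that is 1 at `⊥₋` and
-- sums to zero over every nontrivial interval from `⊥₋` must be the Möbius function. The check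
-- telescopes. With rows counted from 0, the two weighted cells of a row j ≥ i contribute
-- `a (suc j) - a j` to the ideal below (i,c), where `a j` indicates that j is less than both r and
-- c; the total is `a r - a i`, which is 0 - 1 and cancels the 1 at `⊥₋`. The obstacle is a row of
-- width one, which has no second cell; such a row can only be the last, where the second weight is
-- 0 anyway.
--
-- In type C the simple root on the last axis changes the total coordinate sum by 2, so pointwise
-- comparison of partial sums yields the root order only together with a parity condition. It always
-- holds, because a positive root of type C has total 0 or 2. Both types are treated by one formula,
-- in which columns from r on are reflected to a coordinate index; only the centre of the reflection
-- depends on the type.

Σℤ : List ℤ → ℤ
Σℤ = foldr ℤ._+_ 0ℤ

Σℤ-++ : ∀ xs ys → Σℤ (xs ++ ys) ≡ Σℤ xs ℤ.+ Σℤ ys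
Σℤ-++ []       ys = sym (ℤ.+-identityˡ _)
Σℤ-++ (x ∷ xs) ys = trans (cong (ℤ._+_ x) (Σℤ-++ xs ys)) (sym (ℤ.+-assoc x _ _))

module _ {A : Set} where

  Σℤ-zero : ∀ {f : A → ℤ} xs → All.All (λ x → f x ≡ 0ℤ) xs → Σℤ (map f xs) ≡ 0ℤ
  Σℤ-zero []       All.[]         = refl
  Σℤ-zero (x ∷ xs) (fx≡0 All.∷ p) = cong₂ ℤ._+_ fx≡0 (Σℤ-zero xs p)

  Σℤ-+ : ∀ (f g : A → ℤ) xs → Σℤ (map (λ x → f x ℤ.+ g x) xs) ≡ Σℤ (map f xs) ℤ.+ Σℤ (map g xs)
  Σℤ-+ f g []       = refl
  Σℤ-+ f g (x ∷ xs) = trans (cong (ℤ._+_ (f x ℤ.+ g x)) (Σℤ-+ f g xs)) (interchange (f x) (g x) _ _)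
    where
    interchange : ∀ a b c d → a ℤ.+ b ℤ.+ (c ℤ.+ d) ≡ a ℤ.+ c ℤ.+ (b ℤ.+ d)
    interchange = solve-∀

  Σℤ-concatMap : ∀ {B : Set} (f : B → ℤ) (g : A → List B) xs →
                 Σℤ (map f (concatMap g xs)) ≡ Σℤ (map (λ x → Σℤ (map f (g x))) xs)
  Σℤ-concatMap f g []       = refl
  Σℤ-concatMap f g (x ∷ xs) = begin
    Σℤ (map f (g x ++ concatMap g xs))                 ≡⟨ cong Σℤ (map-++ f (g x) _) ⟩
    Σℤ (map f (g x) ++ map f (concatMap g xs))         ≡⟨ Σℤ-++ (map f (g x)) _ ⟩
    Σℤ (map f (g x)) ℤ.+ Σℤ (map f (concatMap g xs))   ≡⟨ cong (ℤ._+_ (Σℤ (map f (g x)))) (Σℤ-concatMap f g xs) ⟩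
    Σℤ (map (λ x → Σℤ (map f (g x))) (x ∷ xs))         ∎
    where open ≡-Reasoning

Σℤ-allFin : ∀ {n} (f : Fin n → ℤ) → Σℤ (map f (allFin n)) ≡ ∑ f
Σℤ-allFin f = trans (cong Σℤ (map-tabulate (λ i → i) f)) (Σℤ-tabulate f)
  where
  Σℤ-tabulate : ∀ {n} (f : Fin n → ℤ) → Σℤ (tabulate f) ≡ ∑ f
  Σℤ-tabulate {zero}  f = refl
  Σℤ-tabulate {suc n} f = cong (ℤ._+_ (f Fin.zero)) (Σℤ-tabulate (f ∘ Fin.suc))

⟦_⟧ : Bool → ℤ
⟦ p ⟧ = if p then 1ℤ else 0ℤ

if-∧ : ∀ p q x → (if p ∧ q then x else 0ℤ) ≡ x ℤ.* (⟦ p ⟧ ℤ.* ⟦ q ⟧)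
if-∧ true  true  x = sym (ℤ.*-identityʳ x)
if-∧ true  false x = sym (ℤ.*-zeroʳ x)
if-∧ false q     x = sym (ℤ.*-zeroʳ x)

-- Written with `_<ᵇ_` because the decision procedure of the cell order computes to this Boolean,
-- and because a common successor in both arguments then cancels by computation.
step : ℕ → ℕ → ℤ
step a k = ⟦ a <ᵇ k ⟧

step-< : ∀ {a k} → a < k → step a k ≡ 1ℤ
step-< {zero}  {suc k} _         = refl
step-< {suc a} {suc k} (s≤s a<k) = step-< a<k

step-≥ : ∀ {a k} → k ≤ a → step a k ≡ 0ℤ
step-≥ {a}     {zero}  _         = refl
step-≥ {suc a} {suc k} (s≤s k≤a) = step-≥ k≤a

-- The step factor switches off the indices below i, and the differences that remain telescope.
∑-telescope : ∀ {r} i (a : ℕ → ℤ) → i ≤ r →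
              ∑ {r} (λ j → step i (suc (toℕ j)) ℤ.* (a (suc (toℕ j)) ℤ.- a (toℕ j))) ≡ a r ℤ.- a i
∑-telescope {zero}  zero    a _ = sym (ℤ.+-inverseʳ (a 0))
∑-telescope {suc r} zero    a _ =
  trans (cong (ℤ._+_ (1ℤ ℤ.* (a 1 ℤ.- a 0))) (∑-telescope {r} 0 (a ∘ suc) z≤n)) (cancel (a 0) (a 1) (a (suc r)))
  where
  cancel : ∀ p q s → 1ℤ ℤ.* (q ℤ.- p) ℤ.+ (s ℤ.- q) ≡ s ℤ.- p
  cancel = solve-∀
∑-telescope {suc r} (suc i) a (s≤s i≤r) =
  trans (ℤ.+-identityˡ _) (∑-telescope {r} i (a ∘ suc) i≤r)

-- For n = 1 the index 1 is out of range, and the last hypothesis makes the absent term harmless.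
∑-head : ∀ {n} (f : ℕ → ℤ) → (∀ k → f (suc (suc k)) ≡ 0ℤ) → 1 ≤ n → (n ≡ 1 → f 1 ≡ 0ℤ) →
         ∑ {n} (f ∘ toℕ) ≡ f 0 ℤ.+ f 1
∑-head {suc zero}    f _ _ f₁≡0 = cong (ℤ._+_ (f 0)) (sym (f₁≡0 refl))
∑-head {suc (suc n)} f f≡0 _ _  = cong (ℤ._+_ (f 0)) (begin
  f 1 ℤ.+ ∑ {n} (λ k → f (suc (suc (toℕ k)))) ≡⟨ cong (ℤ._+_ (f 1)) (sum-cong-≗ {n} (λ k → f≡0 (toℕ k))) ⟩
  f 1 ℤ.+ ∑ {n} (λ _ → 0ℤ)                    ≡⟨ cong (ℤ._+_ (f 1)) (sum-replicate-zero n) ⟩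
  f 1 ℤ.+ 0ℤ                                  ≡⟨ ℤ.+-identityʳ (f 1) ⟩
  f 1                                         ∎)
  where open ≡-Reasoning

∑-step : ∀ m p q → ∑ {suc m} (λ j → step (toℕ j) m ℤ.* p ℤ.- q) ≡ ℤ.+ m ℤ.* p ℤ.- ℤ.+ suc m ℤ.* q
∑-step zero    p q = base p q
  where
  base : ∀ p q → 0ℤ ℤ.* p ℤ.- q ℤ.+ 0ℤ ≡ 0ℤ ℤ.* p ℤ.- 1ℤ ℤ.* q
  base = solve-∀
∑-step (suc m) p q = begin
  1ℤ ℤ.* p ℤ.- q ℤ.+ ∑ {suc m} (λ j → step (toℕ j) m ℤ.* p ℤ.- q)
    ≡⟨ cong (ℤ._+_ (1ℤ ℤ.* p ℤ.- q)) (∑-step m p q) ⟩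
  1ℤ ℤ.* p ℤ.- q ℤ.+ (ℤ.+ m ℤ.* p ℤ.- ℤ.+ suc m ℤ.* q)
    ≡⟨ collect (ℤ.+ m) (ℤ.+ suc m) p q ⟩
  (1ℤ ℤ.+ ℤ.+ m) ℤ.* p ℤ.- (1ℤ ℤ.+ ℤ.+ suc m) ℤ.* q ∎
  where
  open ≡-Reasoning
  collect : ∀ m n p q → 1ℤ ℤ.* p ℤ.- q ℤ.+ (m ℤ.* p ℤ.- n ℤ.* q) ≡ (1ℤ ℤ.+ m) ℤ.* p ℤ.- (1ℤ ℤ.+ n) ℤ.* q
  collect = solve-∀

-- Coefficients of polynomials

coeff-+ₚ : ∀ p q n → coeff (p +ₚ q) n ≡ coeff p n ℤ.+ coeff q n
coeff-+ₚ []      q       n       = sym (ℤ.+-identityˡ _)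
coeff-+ₚ (a ∷ p) []      n       = sym (ℤ.+-identityʳ _)
coeff-+ₚ (a ∷ p) (b ∷ q) zero    = refl
coeff-+ₚ (a ∷ p) (b ∷ q) (suc n) = coeff-+ₚ p q n

coeff-map : ∀ {f : ℤ → ℤ} → f 0ℤ ≡ 0ℤ → ∀ p n → coeff (map f p) n ≡ f (coeff p n)
coeff-map f0≡0 []      n       = sym f0≡0
coeff-map f0≡0 (a ∷ p) zero    = refl
coeff-map f0≡0 (a ∷ p) (suc n) = coeff-map f0≡0 p n

coeff-minusₚ : ∀ p q n → coeff (p -ₚ q) n ≡ coeff p n ℤ.- coeff q n
coeff-minusₚ p q n = trans (coeff-+ₚ p (map ℤ.-_ q) n) (cong (ℤ._+_ (coeff p n)) (coeff-map refl q n))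

coeff-∷*ₚ : ∀ a p q n → coeff ((a ∷ p) *ₚ q) n ≡ a ℤ.* coeff q n ℤ.+ coeff (0ℤ ∷ p *ₚ q) n
coeff-∷*ₚ a p q n = trans (coeff-+ₚ (map (ℤ._*_ a) q) (0ℤ ∷ p *ₚ q) n)
                          (cong (ℤ._+ coeff (0ℤ ∷ p *ₚ q) n) (coeff-map (ℤ.*-zeroʳ a) q n))

coeff-0∷[] : ∀ n → coeff (0ℤ ∷ []) n ≡ 0ℤ
coeff-0∷[] zero    = refl
coeff-0∷[] (suc n) = refl

coeff-const*ₚ : ∀ a q n → coeff (const a *ₚ q) n ≡ a ℤ.* coeff q n
coeff-const*ₚ a q n = trans (coeff-∷*ₚ a [] q n)
  (trans (cong (ℤ._+_ (a ℤ.* coeff q n)) (coeff-0∷[] n)) (ℤ.+-identityʳ _))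

coeff-foldr : ∀ {A : Set} (p : A → Polynomial) xs n →
              coeff (foldr _+ₚ_ [] (map p xs)) n ≡ Σℤ (map (λ x → coeff (p x) n) xs)
coeff-foldr p []       n = refl
coeff-foldr p (x ∷ xs) n = trans (coeff-+ₚ (p x) _ n) (cong (ℤ._+_ (coeff (p x) n)) (coeff-foldr p xs n))

∷-cong : ∀ a {p q} → p ≈ₚ q → a ∷ p ≈ₚ a ∷ q
∷-cong a p≈q zero    = refl
∷-cong a p≈q (suc n) = p≈q n

0∷*ₚ : ∀ p q → (0ℤ ∷ p) *ₚ q ≈ₚ 0ℤ ∷ p *ₚ q
0∷*ₚ p q n = trans (coeff-∷*ₚ 0ℤ p q n) (ℤ.+-identityˡ _)

-- Lists that are equal as polynomials may differ in length; this handles the trailing zeros in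
-- `*ₚ-congʳ`.
*ₚ-zeroˡ : ∀ p q → p ≈ₚ [] → p *ₚ q ≈ₚ []
*ₚ-zeroˡ []      q p≈0 n = refl
*ₚ-zeroˡ (a ∷ p) q p≈0 n = begin
  coeff ((a ∷ p) *ₚ q) n                        ≡⟨ coeff-∷*ₚ a p q n ⟩
  a ℤ.* coeff q n ℤ.+ coeff (0ℤ ∷ p *ₚ q) n     ≡⟨ cong₂ (λ x z → x ℤ.* coeff q n ℤ.+ z) (p≈0 0)
                                                     (∷-cong 0ℤ (*ₚ-zeroˡ p q (p≈0 ∘ suc)) n) ⟩
  0ℤ ℤ.+ coeff (0ℤ ∷ []) n                      ≡⟨ cong (ℤ._+_ 0ℤ) (coeff-0∷[] n) ⟩
  0ℤ                                            ∎
  where open ≡-Reasoning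

*ₚ-congʳ : ∀ p p′ q → p ≈ₚ p′ → p *ₚ q ≈ₚ p′ *ₚ q
*ₚ-congʳ []      p′       q p≈p′ n = sym (*ₚ-zeroˡ p′ q (sym ∘ p≈p′) n)
*ₚ-congʳ (a ∷ p) []       q p≈p′ n = *ₚ-zeroˡ (a ∷ p) q p≈p′ n
*ₚ-congʳ (a ∷ p) (b ∷ p′) q p≈p′ n = begin
  coeff ((a ∷ p) *ₚ q) n                        ≡⟨ coeff-∷*ₚ a p q n ⟩
  a ℤ.* coeff q n ℤ.+ coeff (0ℤ ∷ p *ₚ q) n     ≡⟨ cong₂ (λ x z → x ℤ.* coeff q n ℤ.+ z) (p≈p′ 0)
                                                     (∷-cong 0ℤ (*ₚ-congʳ p p′ q (p≈p′ ∘ suc)) n) ⟩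
  b ℤ.* coeff q n ℤ.+ coeff (0ℤ ∷ p′ *ₚ q) n    ≡⟨ coeff-∷*ₚ b p′ q n ⟨
  coeff ((b ∷ p′) *ₚ q) n                       ∎
  where open ≡-Reasoning

y*ₚ : ∀ p → y *ₚ p ≈ₚ 0ℤ ∷ p
y*ₚ p n = trans (0∷*ₚ (const 1ℤ) p n)
  (∷-cong 0ℤ (λ k → trans (coeff-const*ₚ 1ℤ p k) (ℤ.*-identityˡ _)) n)

coeff-y*ₚ-suc : ∀ p n → coeff (y *ₚ p) (suc n) ≡ coeff p n
coeff-y*ₚ-suc p n = y*ₚ p (suc n)

y^suc*ₚ : ∀ n p q → y ^ₚ suc n *ₚ p *ₚ q ≈ₚ 0ℤ ∷ y ^ₚ n *ₚ p *ₚ q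
y^suc*ₚ n p q k = begin
  coeff (y ^ₚ suc n *ₚ p *ₚ q) k        ≡⟨ *ₚ-congʳ (y ^ₚ suc n *ₚ p) ((0ℤ ∷ y ^ₚ n) *ₚ p) q
                                             (*ₚ-congʳ (y ^ₚ suc n) (0ℤ ∷ y ^ₚ n) p (y*ₚ (y ^ₚ n))) k ⟩
  coeff ((0ℤ ∷ y ^ₚ n) *ₚ p *ₚ q) k     ≡⟨ *ₚ-congʳ ((0ℤ ∷ y ^ₚ n) *ₚ p) (0ℤ ∷ y ^ₚ n *ₚ p) q (0∷*ₚ (y ^ₚ n) p) k ⟩
  coeff ((0ℤ ∷ y ^ₚ n *ₚ p) *ₚ q) k     ≡⟨ 0∷*ₚ (y ^ₚ n *ₚ p) q k ⟩
  coeff (0ℤ ∷ y ^ₚ n *ₚ p *ₚ q) k       ∎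
  where open ≡-Reasoning

-- Each factor `y` shifts the coefficients by one place, so induction on n leaves only the product
-- of the two linear factors to expand, in the clauses for n = 0.
factorised : ∀ a n k →
  coeff (y ^ₚ n *ₚ (y -ₚ const 1ℤ) *ₚ (y -ₚ const a)) k ≡
  coeff (y ^ₚ suc (suc n)) k ℤ.- (a ℤ.+ 1ℤ) ℤ.* coeff (y ^ₚ suc n) k ℤ.+ a ℤ.* coeff (y ^ₚ n) k
factorised a zero zero = constant a
  where
  constant : ∀ a → -1ℤ ℤ.* (0ℤ ℤ.- a) ℤ.+ 0ℤ ≡ 0ℤ ℤ.- (a ℤ.+ 1ℤ) ℤ.* 0ℤ ℤ.+ a ℤ.* 1ℤ
  constant = solve-∀
factorised a zero (suc zero) = linear a
  where
  linear : ∀ a → -1ℤ ℤ.* 1ℤ ℤ.+ (1ℤ ℤ.* (0ℤ ℤ.- a) ℤ.+ 0ℤ) ≡ 0ℤ ℤ.- (a ℤ.+ 1ℤ) ℤ.* 1ℤ ℤ.+ a ℤ.* 0ℤ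
  linear = solve-∀
factorised a zero (suc (suc zero)) = quadratic a
  where
  quadratic : ∀ a → 1ℤ ≡ 1ℤ ℤ.- (a ℤ.+ 1ℤ) ℤ.* 0ℤ ℤ.+ a ℤ.* 0ℤ
  quadratic = solve-∀
factorised a zero (suc (suc (suc k))) = vanishing a
  where
  vanishing : ∀ a → 0ℤ ≡ 0ℤ ℤ.- (a ℤ.+ 1ℤ) ℤ.* 0ℤ ℤ.+ a ℤ.* 0ℤ
  vanishing = solve-∀
factorised a (suc n) zero = trans
  (y^suc*ₚ n (y -ₚ const 1ℤ) (y -ₚ const a) 0)
  (sym (begin
    coeff (y ^ₚ suc (suc (suc n))) 0 ℤ.- (a ℤ.+ 1ℤ) ℤ.* coeff (y ^ₚ suc (suc n)) 0 ℤ.+ a ℤ.* coeff (y ^ₚ suc n) 0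
      ≡⟨ cong₂ ℤ._+_ (cong₂ (λ u v → u ℤ.- (a ℤ.+ 1ℤ) ℤ.* v) (y*ₚ (y ^ₚ suc (suc n)) 0) (y*ₚ (y ^ₚ suc n) 0))
           (cong (ℤ._*_ a) (y*ₚ (y ^ₚ n) 0)) ⟩
    0ℤ ℤ.- (a ℤ.+ 1ℤ) ℤ.* 0ℤ ℤ.+ a ℤ.* 0ℤ
      ≡⟨ vanishing a ⟩
    0ℤ ∎))
  where
  open ≡-Reasoning
  vanishing : ∀ a → 0ℤ ℤ.- (a ℤ.+ 1ℤ) ℤ.* 0ℤ ℤ.+ a ℤ.* 0ℤ ≡ 0ℤ
  vanishing = solve-∀
factorised a (suc n) (suc k) = begin
  coeff (y ^ₚ suc n *ₚ (y -ₚ const 1ℤ) *ₚ (y -ₚ const a)) (suc k)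
    ≡⟨ y^suc*ₚ n (y -ₚ const 1ℤ) (y -ₚ const a) (suc k) ⟩
  coeff (y ^ₚ n *ₚ (y -ₚ const 1ℤ) *ₚ (y -ₚ const a)) k
    ≡⟨ factorised a n k ⟩
  coeff (y ^ₚ suc (suc n)) k ℤ.- (a ℤ.+ 1ℤ) ℤ.* coeff (y ^ₚ suc n) k ℤ.+ a ℤ.* coeff (y ^ₚ n) k
    ≡⟨ cong₂ ℤ._+_ (cong₂ (λ u v → u ℤ.- (a ℤ.+ 1ℤ) ℤ.* v) (coeff-y*ₚ-suc (y ^ₚ suc (suc n)) k)
                      (coeff-y*ₚ-suc (y ^ₚ suc n) k))
         (cong (ℤ._*_ a) (coeff-y*ₚ-suc (y ^ₚ n) k)) ⟨
  coeff (y ^ₚ suc (suc (suc n))) (suc k) ℤ.- (a ℤ.+ 1ℤ) ℤ.* coeff (y ^ₚ suc (suc n)) (suc k)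
    ℤ.+ a ℤ.* coeff (y ^ₚ suc n) (suc k) ∎
  where open ≡-Reasoning

-- The Möbius function and the characteristic polynomial

module _ (P : FinitePoset) where
  open FinitePoset P renaming (_≤_ to _⊑_; _<_ to _⊏_)

  -- Membership provides one summand at z, and uniqueness excludes a second.
  Σℤ-δ : ∀ (g : Carrier → ℤ) z {xs} → Unique xs → z ∈ xs →
         Σℤ (map (λ w → if ⌊ w ≟ z ⌋ then g w else 0ℤ) xs) ≡ g z
  Σℤ-δ g z {x ∷ xs} (x∉xs AllPairs.∷ _) (here refl) with z ≟ z
  ... | no z≢z = contradiction refl z≢z
  ... | yes _  = trans (cong (ℤ._+_ (g z)) (Σℤ-zero xs (All.map off x∉xs))) (ℤ.+-identityʳ (g z))
    where
    off : ∀ {w} → z ≢ w → (if ⌊ w ≟ z ⌋ then g w else 0ℤ) ≡ 0ℤ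
    off {w} z≢w with w ≟ z
    ... | yes refl = contradiction refl z≢w
    ... | no _     = refl
  Σℤ-δ g z {x ∷ xs} (x∉xs AllPairs.∷ u) (there z∈xs) with x ≟ z
  ... | yes refl = contradiction refl (All.lookup x∉xs z∈xs)
  ... | no _     = trans (ℤ.+-identityˡ _) (Σℤ-δ g z u z∈xs)

  -- Well-founded induction: once g agrees with the Möbius function strictly below z, the vanishing
  -- sum over the closed interval is the Möbius recursion solved for `g z`.
  μ-unique : ∀ x (g : Carrier → ℤ) → g x ≡ 1ℤ →
             (∀ z → x ⊑ z → x ≢ z →
                Σℤ (map (λ w → if ⌊ x ≤? w ×-dec w ≤? z ⌋ then g w else 0ℤ) elements) ≡ 0ℤ) →
             ∀ z → x ⊑ z → μ P x z ≡ g z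
  μ-unique x g gx≡1 Σg≡0 z = go z (<-wellFounded z) (x ≟ z)
    where
    go : ∀ z → Acc _⊏_ z → Dec (x ≡ z) → x ⊑ z → μ P x z ≡ g z
    go z _        (yes refl) x⊑z = trans (μ-refl P x) (sym gx≡1)
    go z (acc rs) (no x≢z)   x⊑z = begin
      μ P x z                               ≡⟨ μ-rec P x≢z ⟩
      ℤ.- Σℤ (map below elements)           ≡⟨ cong ℤ.-_ (solved (Σℤ (map below elements)) (g z) total) ⟩
      ℤ.- (ℤ.- g z)                         ≡⟨ ℤ.neg-involutive (g z) ⟩
      g z                                   ∎
      where
      open ≡-Reasoning

      below diagonal upTo : Carrier → ℤ
      below    w = if ⌊ x ≤? w ×-dec w <? z ⌋ then μ P x w else 0ℤ
      diagonal w = if ⌊ w ≟ z ⌋ then g w else 0ℤ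
      upTo     w = if ⌊ x ≤? w ×-dec w ≤? z ⌋ then g w else 0ℤ

      -- The closed interval is the half-open one plus its top z; on the half-open part the
      -- induction hypothesis exchanges g and `μ P x`.
      split : ∀ w → upTo w ≡ below w ℤ.+ diagonal w
      split w with w ≟ z | x ≤? w | w ≤? z | w <? z
      ... | yes refl | no x⋢w  | _       | _              = contradiction x⊑z x⋢w
      ... | yes refl | _       | no w⋢z  | _              = contradiction (IsPartialOrder.refl isPartialOrder) w⋢z
      ... | yes refl | _       | _       | yes (_ , w≢z)  = contradiction refl w≢z
      ... | yes refl | yes _   | yes _   | no _           = sym (ℤ.+-identityˡ _)
      ... | no w≢z   | yes x⊑w | yes _   | yes w⊏z        =
        trans (sym (go w (rs w⊏z) (x ≟ w) x⊑w)) (sym (ℤ.+-identityʳ _))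
      ... | no w≢z   | yes _   | yes w⊑z | no w⊏̸z         = contradiction (w⊑z , w≢z) w⊏̸z
      ... | no w≢z   | yes _   | no w⋢z  | yes (w⊑z , _)  = contradiction w⊑z w⋢z
      ... | no w≢z   | yes _   | no _    | no _           = refl
      ... | no w≢z   | no _    | _       | _              = refl

      total : Σℤ (map below elements) ℤ.+ g z ≡ 0ℤ
      total = begin
        Σℤ (map below elements) ℤ.+ g z
          ≡⟨ cong (ℤ._+_ (Σℤ (map below elements))) (Σℤ-δ g z elements-unique (elements-complete z)) ⟨
        Σℤ (map below elements) ℤ.+ Σℤ (map diagonal elements)
          ≡⟨ Σℤ-+ below diagonal elements ⟨
        Σℤ (map (λ w → below w ℤ.+ diagonal w) elements)
          ≡⟨ cong Σℤ (map-cong split elements) ⟨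
        Σℤ (map upTo elements)
          ≡⟨ Σg≡0 z x⊑z x≢z ⟩
        0ℤ ∎

      solved : ∀ p q → p ℤ.+ q ≡ 0ℤ → p ≡ ℤ.- q
      solved p q p+q≡0 = begin
        p                   ≡⟨ expand p q ⟩
        p ℤ.+ q ℤ.- q       ≡⟨ cong (ℤ._- q) p+q≡0 ⟩
        0ℤ ℤ.- q            ≡⟨ ℤ.+-identityˡ (ℤ.- q) ⟩
        ℤ.- q               ∎
        where
        expand : ∀ a b → a ≡ a ℤ.+ b ℤ.- b
        expand = solve-∀

-- The Möbius function of the Ferrers-cell poset

module _ {m} (b : Vector ℕ (suc m)) (antitone : ∀ {i j} → i Fin.≤ j → b j ≤ b i)
         (pos≤b : ∀ i → pos i ≤ b i) where
  private
    r = suc m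

  -- The arguments are the row, counted from 0, and the distance from the diagonal. At distance 1
  -- the last row gets 0, since its cell there lies above a single atom.
  weight : ℕ → ℕ → ℤ
  weight j zero          = -1ℤ
  weight j (suc zero)    = step (suc j) r
  weight j (suc (suc _)) = 0ℤ

  μ̂ : Cell b ₋ → ℤ
  μ̂ ⊥₋    = 1ℤ
  μ̂ [ u ] = weight (toℕ (Cell.row u)) (Cell.col u ∸ pos (Cell.row u))

  -- If a next row exists, it reaches its own diagonal, and row j is at least as long on the right;
  -- row j then has at least two cells.
  last-row : ∀ j → b j ∸ toℕ j ≡ 1 → step (suc (toℕ j)) r ≡ 0ℤ
  last-row j width≡1 = step-≥ (ℕ.≮⇒≥ λ 1+j<r → ℕ.<-irrefl (sym width≡1) (ℕ.m+n≤o⇒m≤o∸n 2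
    (ℕ.≤-trans (ℕ.≤-reflexive (cong suc (sym (Fin.toℕ-fromℕ< 1+j<r))))
      (ℕ.≤-trans (pos≤b (fromℕ< 1+j<r))
        (antitone (ℕ.≤-trans (ℕ.n≤1+n (toℕ j)) (ℕ.≤-reflexive (sym (Fin.toℕ-fromℕ< 1+j<r)))))))))

  -- Used twice: with φ the indicator of an ideal to verify the interval sums, and with φ a
  -- coefficient of a power of `y` to evaluate `X`.
  Σ-μ̂ : ∀ (f : Cell b ₋ → ℤ) (φ : ℕ → ℕ → ℤ) →
        (∀ j k → f [ rowCell b j k ] ≡ weight (toℕ j) (toℕ k) ℤ.* φ (toℕ j) (toℕ k)) →
        Σℤ (map f (FinitePoset.elements (F̂ b))) ≡
        f ⊥₋ ℤ.+ ∑ {r} (λ j → step (suc (toℕ j)) r ℤ.* φ (toℕ j) 1 ℤ.- φ (toℕ j) 0)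
  Σ-μ̂ f φ f≡ = cong (ℤ._+_ (f ⊥₋)) (begin
    Σℤ (map f (map [_] (cells b)))
      ≡⟨ cong Σℤ (map-∘ (cells b)) ⟨
    Σℤ (map (f ∘ [_]) (cells b))
      ≡⟨ Σℤ-concatMap (f ∘ [_]) (rowCells b) (allFin r) ⟩
    Σℤ (map (λ j → Σℤ (map (f ∘ [_]) (rowCells b j))) (allFin r))
      ≡⟨ Σℤ-allFin (λ j → Σℤ (map (f ∘ [_]) (rowCells b j))) ⟩
    ∑ (λ j → Σℤ (map (f ∘ [_]) (rowCells b j)))
      ≡⟨ sum-cong-≗ row-sum ⟩
    ∑ {r} (λ j → step (suc (toℕ j)) r ℤ.* φ (toℕ j) 1 ℤ.- φ (toℕ j) 0) ∎)
    where
    open ≡-Reasoning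

    swap : ∀ p q → -1ℤ ℤ.* p ℤ.+ q ≡ q ℤ.- p
    swap = solve-∀

    row-sum : ∀ j → Σℤ (map (f ∘ [_]) (rowCells b j)) ≡
              step (suc (toℕ j)) r ℤ.* φ (toℕ j) 1 ℤ.- φ (toℕ j) 0
    row-sum j = begin
      Σℤ (map (f ∘ [_]) (map (rowCell b j) (allFin (b j ∸ toℕ j))))
        ≡⟨ cong Σℤ (map-∘ (allFin (b j ∸ toℕ j))) ⟨
      Σℤ (map (λ k → f [ rowCell b j k ]) (allFin (b j ∸ toℕ j)))
        ≡⟨ Σℤ-allFin (λ k → f [ rowCell b j k ]) ⟩
      ∑ (λ k → f [ rowCell b j k ])
        ≡⟨ sum-cong-≗ (f≡ j) ⟩
      ∑ {b j ∸ toℕ j} (λ k → weight (toℕ j) (toℕ k) ℤ.* φ (toℕ j) (toℕ k))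
        ≡⟨ ∑-head (λ k → weight (toℕ j) k ℤ.* φ (toℕ j) k) (λ _ → refl)
             (ℕ.m+n≤o⇒m≤o∸n 1 (pos≤b j)) (λ width≡1 → cong (ℤ._* φ (toℕ j) 1) (last-row j width≡1)) ⟩
      -1ℤ ℤ.* φ (toℕ j) 0 ℤ.+ step (suc (toℕ j)) r ℤ.* φ (toℕ j) 1
        ≡⟨ swap (φ (toℕ j) 0) _ ⟩
      step (suc (toℕ j)) r ℤ.* φ (toℕ j) 1 ℤ.- φ (toℕ j) 0 ∎

  μ̂-rowCell : ∀ j k → μ̂ [ rowCell b j k ] ≡ weight (toℕ j) (toℕ k)
  μ̂-rowCell j k = cong (weight (toℕ j)) (ℕ.m+n∸m≡n (pos j) (toℕ k))

  open FinitePoset (F̂ b) using (_≤?_; elements)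

  Σ-μ̂-interval : ∀ u → Σℤ (map (λ w → if ⌊ ⊥₋ ≤? w ×-dec w ≤? [ u ] ⌋ then μ̂ w else 0ℤ) elements) ≡ 0ℤ
  Σ-μ̂-interval u@(cell i c i<c _) = begin
    Σℤ (map f elements)
      ≡⟨ Σ-μ̂ f (λ j k → step (toℕ i) (suc j) ℤ.* step (j + k) c) f≡ ⟩
    1ℤ ℤ.+ ∑ {r} (λ j → step (suc (toℕ j)) r ℤ.* (step (toℕ i) (suc (toℕ j)) ℤ.* step (toℕ j + 1) c)
                        ℤ.- step (toℕ i) (suc (toℕ j)) ℤ.* step (toℕ j + 0) c)
      ≡⟨ cong (ℤ._+_ 1ℤ) (sum-cong-≗ {r} term) ⟩
    1ℤ ℤ.+ ∑ {r} (λ j → step (toℕ i) (suc (toℕ j)) ℤ.* (a (suc (toℕ j)) ℤ.- a (toℕ j)))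
      ≡⟨ cong (ℤ._+_ 1ℤ) (∑-telescope (toℕ i) a (ℕ.<⇒≤ (Fin.toℕ<n i))) ⟩
    1ℤ ℤ.+ (a r ℤ.- a (toℕ i))
      -- `a r` vanishes by its first factor, while `a (toℕ i)` is 1 because the index of row i,
      -- counted from 0, is less than r and less than c.
      ≡⟨ cong₂ (λ p q → 1ℤ ℤ.+ (p ℤ.- q)) (cong (ℤ._* step r c) (step-≥ (ℕ.≤-refl {r})))
           (cong₂ ℤ._*_ (step-< (Fin.toℕ<n i)) (step-< (recompute (pos i ℕ.≤? c) i<c))) ⟩
    0ℤ ∎
    where
    open ≡-Reasoning

    a : ℕ → ℤ
    a j = step j r ℤ.* step j c

    f : Cell b ₋ → ℤ
    f w = if ⌊ ⊥₋ ≤? w ×-dec w ≤? [ u ] ⌋ then μ̂ w else 0ℤ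

    f≡ : ∀ j k → f [ rowCell b j k ] ≡
         weight (toℕ j) (toℕ k) ℤ.* (step (toℕ i) (suc (toℕ j)) ℤ.* step (toℕ j + toℕ k) c)
    f≡ j k = trans
      -- Passing from `⌊_⌋` to `does` lets the decision compute to the conjunction of the row and
      -- column comparisons.
      (cong (if_then μ̂ w else 0ℤ) (isYes≗does (⊥₋ ≤? w ×-dec w ≤? [ u ])))
      (trans (if-∧ (toℕ i <ᵇ suc (toℕ j)) (toℕ j + toℕ k <ᵇ c) (μ̂ w))
             (cong (ℤ._* (step (toℕ i) (suc (toℕ j)) ℤ.* step (toℕ j + toℕ k) c)) (μ̂-rowCell j k)))
      where w = [ rowCell b j k ]

    factor : ∀ p s q t → q ℤ.* (s ℤ.* p) ℤ.- s ℤ.* t ≡ s ℤ.* (q ℤ.* p ℤ.- 1ℤ ℤ.* t)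
    factor = solve-∀

    term : ∀ (j : Fin r) → _
    term j = begin
      step (suc (toℕ j)) r ℤ.* (step (toℕ i) (suc (toℕ j)) ℤ.* step (toℕ j + 1) c)
        ℤ.- step (toℕ i) (suc (toℕ j)) ℤ.* step (toℕ j + 0) c
        ≡⟨ cong₂ (λ x y → step (suc (toℕ j)) r ℤ.* (step (toℕ i) (suc (toℕ j)) ℤ.* step x c)
                   ℤ.- step (toℕ i) (suc (toℕ j)) ℤ.* step y c)
             (ℕ.+-comm (toℕ j) 1) (ℕ.+-identityʳ (toℕ j)) ⟩
      step (suc (toℕ j)) r ℤ.* (step (toℕ i) (suc (toℕ j)) ℤ.* step (suc (toℕ j)) c)
        ℤ.- step (toℕ i) (suc (toℕ j)) ℤ.* step (toℕ j) c
        ≡⟨ factor (step (suc (toℕ j)) c) (step (toℕ i) (suc (toℕ j))) (step (suc (toℕ j)) r) (step (toℕ j) c) ⟩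
      step (toℕ i) (suc (toℕ j)) ℤ.* (a (suc (toℕ j)) ℤ.- 1ℤ ℤ.* step (toℕ j) c)
        -- The factor 1 is read as `step (toℕ j) r`, which completes the last term to `a (toℕ j)`.
        ≡⟨ cong (λ x → step (toℕ i) (suc (toℕ j)) ℤ.* (a (suc (toℕ j)) ℤ.- x ℤ.* step (toℕ j) c))
             (step-< (Fin.toℕ<n j)) ⟨
      step (toℕ i) (suc (toℕ j)) ℤ.* (a (suc (toℕ j)) ℤ.- a (toℕ j)) ∎

  μ≡μ̂ : ∀ z → μ (F̂ b) ⊥₋ z ≡ μ̂ z
  μ≡μ̂ z = μ-unique (F̂ b) ⊥₋ μ̂ refl
    (λ { ⊥₋ _ ⊥≢⊥ → contradiction refl ⊥≢⊥ ; [ u ] _ _ → Σ-μ̂-interval u }) z (⊥₋≤ z)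

  coeff-X : ∀ n → coeff (X b) n ≡
            coeff (y ^ₚ b₁ b) n ℤ.- ℤ.+ suc m ℤ.* coeff (y ^ₚ (b₁ b ∸ 1)) n
                                ℤ.+ ℤ.+ m ℤ.* coeff (y ^ₚ (b₁ b ∸ 2)) n
  coeff-X n = begin
    coeff (X b) n
      ≡⟨ coeff-foldr (λ x → const (μ (F̂ b) ⊥₋ x) *ₚ y ^ₚ (b₁ b ∸ ρ̂ x)) elements n ⟩
    Σℤ (map (λ x → coeff (const (μ (F̂ b) ⊥₋ x) *ₚ y ^ₚ (b₁ b ∸ ρ̂ x)) n) elements)
      ≡⟨ cong Σℤ (map-cong (λ x → trans (coeff-const*ₚ (μ (F̂ b) ⊥₋ x) (y ^ₚ (b₁ b ∸ ρ̂ x)) n)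
                                        (cong (ℤ._* c (ρ̂ x)) (μ≡μ̂ x))) elements) ⟩
    Σℤ (map (λ x → μ̂ x ℤ.* c (ρ̂ x)) elements)
      -- A cell at distance k from the diagonal has rank `suc k`, whatever its row.
      ≡⟨ Σ-μ̂ (λ x → μ̂ x ℤ.* c (ρ̂ x)) (λ _ k → c (suc k))
           (λ j k → cong₂ (λ u v → u ℤ.* c (suc v)) (μ̂-rowCell j k)
                      (ℕ.m+n∸m≡n (pos j) (toℕ k))) ⟩
    1ℤ ℤ.* c 0 ℤ.+ ∑ {suc m} (λ j → step (suc (toℕ j)) (suc m) ℤ.* c 2 ℤ.- c 1)
      ≡⟨ cong (ℤ._+_ (1ℤ ℤ.* c 0)) (∑-step m (c 2) (c 1)) ⟩
    1ℤ ℤ.* c 0 ℤ.+ (ℤ.+ m ℤ.* c 2 ℤ.- ℤ.+ suc m ℤ.* c 1)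
      ≡⟨ reorder (ℤ.+ m) (ℤ.+ suc m) (c 0) (c 1) (c 2) ⟩
    c 0 ℤ.- ℤ.+ suc m ℤ.* c 1 ℤ.+ ℤ.+ m ℤ.* c 2 ∎
    where
    open ≡-Reasoning

    c : ℕ → ℤ
    c k = coeff (y ^ₚ (b₁ b ∸ k)) n

    reorder : ∀ m r p q s → 1ℤ ℤ.* p ℤ.+ (m ℤ.* s ℤ.- r ℤ.* q) ≡ p ℤ.- r ℤ.* q ℤ.+ m ℤ.* s
    reorder = solve-∀

  -- The last coefficient computes to `ℤ.+ m`. The exponent `b₁ b ∸ 2` can truncate only for m = 0,
  -- where this coefficient is 0.
  X-formula : X b ≈ₚ y ^ₚ b₁ b -ₚ const (ℤ.+ suc m) *ₚ y ^ₚ (b₁ b ∸ 1)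
                               +ₚ const (ℤ.+ suc m ℤ.- 1ℤ) *ₚ y ^ₚ (b₁ b ∸ 2)
  X-formula n = trans (coeff-X n) (sym (trans
    (coeff-+ₚ (y ^ₚ b₁ b -ₚ const (ℤ.+ suc m) *ₚ y ^ₚ (b₁ b ∸ 1)) _ n)
    (cong₂ ℤ._+_
      (trans (coeff-minusₚ (y ^ₚ b₁ b) _ n)
             (cong (ℤ._-_ (coeff (y ^ₚ b₁ b) n)) (coeff-const*ₚ (ℤ.+ suc m) (y ^ₚ (b₁ b ∸ 1)) n)))
      (coeff-const*ₚ (ℤ.+ m) (y ^ₚ (b₁ b ∸ 2)) n))))

X-cong : ∀ {m} (b b′ : Vector ℕ (suc m)) →
         (∀ {i j} → i Fin.≤ j → b j ≤ b i) → (∀ i → pos i ≤ b i) →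
         (∀ {i j} → i Fin.≤ j → b′ j ≤ b′ i) → (∀ i → pos i ≤ b′ i) →
         b₁ b ≡ b₁ b′ → X b ≈ₚ X b′
X-cong {m} b b′ antitone pos≤b antitone′ pos≤b′ eq n = trans (coeff-X b antitone pos≤b n) (trans
  (cong (λ k → coeff (y ^ₚ k) n ℤ.- ℤ.+ suc m ℤ.* coeff (y ^ₚ (k ∸ 1)) n
               ℤ.+ ℤ.+ m ℤ.* coeff (y ^ₚ (k ∸ 2)) n) eq)
  (sym (coeff-X b′ antitone′ pos≤b′ n)))

-- The balanced boundary

balanced-antitone : ∀ {r} {i j : Fin r} → i Fin.≤ j → balanced r j ≤ balanced r i
balanced-antitone {r} i≤j = ℕ.∸-monoʳ-≤ (2 * r) (s≤s i≤j)

r≤balanced : ∀ {r} (i : Fin r) → r ≤ balanced r i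
r≤balanced {r} i = ℕ.m+n≤o⇒m≤o∸n r (ℕ.+-monoʳ-≤ r (ℕ.≤-trans (Fin.toℕ<n i) (ℕ.m≤m+n r 0)))

pos≤balanced : ∀ {r} (i : Fin r) → pos i ≤ balanced r i
pos≤balanced i = ℕ.≤-trans (Fin.toℕ<n i) (r≤balanced i)

X-balanced : ∀ k → let r = suc (suc k) in
             X (balanced r) ≈ₚ y ^ₚ (2 * r ∸ 3) *ₚ (y -ₚ const 1ℤ) *ₚ (y -ₚ const (ℤ.+ r ℤ.- 1ℤ))
X-balanced k n = begin
  coeff (X (balanced r)) n
    ≡⟨ coeff-X (balanced r) balanced-antitone pos≤balanced n ⟩
  c (2 * r ∸ 1) ℤ.- ℤ.+ r ℤ.* c (2 * r ∸ 1 ∸ 1) ℤ.+ ℤ.+ suc k ℤ.* c (2 * r ∸ 1 ∸ 2)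
    ≡⟨ cong (λ d → c (suc d) ℤ.- ℤ.+ r ℤ.* c d ℤ.+ ℤ.+ suc k ℤ.* c (d ∸ 1)) degree ⟩
  c (suc (suc d)) ℤ.- ℤ.+ r ℤ.* c (suc d) ℤ.+ ℤ.+ suc k ℤ.* c d
    ≡⟨ cong (λ a → c (suc (suc d)) ℤ.- a ℤ.* c (suc d) ℤ.+ ℤ.+ suc k ℤ.* c d) (ℤ.+-comm 1ℤ (ℤ.+ suc k)) ⟩
  c (suc (suc d)) ℤ.- (ℤ.+ suc k ℤ.+ 1ℤ) ℤ.* c (suc d) ℤ.+ ℤ.+ suc k ℤ.* c d
    ≡⟨ factorised (ℤ.+ suc k) d n ⟨
  coeff (y ^ₚ d *ₚ (y -ₚ const 1ℤ) *ₚ (y -ₚ const (ℤ.+ r ℤ.- 1ℤ))) n ∎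
  where
  open ≡-Reasoning
  r = suc (suc k)
  d = 2 * r ∸ 3

  c : ℕ → ℤ
  c e = coeff (y ^ₚ e) n

  -- Only two successors of `2 * r` appear by computation; the third is behind an addition and has
  -- to be moved out.
  degree : 2 * r ∸ 2 ≡ suc d
  degree = trans (ℕ.+-suc k (suc k + 0)) (cong suc (sym (cong (_∸ 1) (ℕ.+-suc k (suc k + 0)))))

-- The lattice structure

private
  module Row {r : ℕ} where
    open import Algebra.Construct.NaturalChoice.Min (Fin.≤-totalOrder r) public
      using (x⊓y≤x; x⊓y≤y; ⊓-glb) renaming (_⊓_ to _⊓ᶠ_)
    open import Algebra.Construct.NaturalChoice.Max (Fin.≤-totalOrder r) public
      using (x≤x⊔y; x≤y⊔x; ⊔-lub; ⊔-sel) renaming (_⊔_ to _⊔ᶠ_)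
  open Row

module _ {r} (b : Vector ℕ r) (antitone : ∀ {i j} → i Fin.≤ j → b j ≤ b i) where
  open FinitePoset (F̂ b) using (isPartialOrder) renaming (_≤_ to _⊑_)

  -- Cells grow towards smaller row indices, and a smaller row index has the larger bound, so the
  -- larger column still fits.
  join : Cell b ₋ → Cell b ₋ → Cell b ₋
  join ⊥₋    v  = v
  join [ u ] ⊥₋ = [ u ]
  join [ cell i c i<c c≤b ] [ cell j d j<d d≤b ] = [ cell (i ⊓ᶠ j) (c ⊔ d)
    (ℕ.≤-trans (s≤s (x⊓y≤x i j)) (ℕ.≤-trans i<c (ℕ.m≤m⊔n c d)))
    (ℕ.⊔-lub (ℕ.≤-trans c≤b (antitone (x⊓y≤x i j))) (ℕ.≤-trans d≤b (antitone (x⊓y≤y i j)))) ]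

  -- The larger row index with the smaller column can fall left of the diagonal; then no cell lies
  -- below both, and the adjoined minimum is the meet.
  meet : Cell b ₋ → Cell b ₋ → Cell b ₋
  meet ⊥₋    v  = ⊥₋
  meet [ u ] ⊥₋ = ⊥₋
  meet [ cell i c i<c c≤b ] [ cell j d j<d d≤b ] with pos (i ⊔ᶠ j) ℕ.≤? c ⊓ d
  ... | no _      = ⊥₋
  ... | yes i⊔j<c⊓d = [ cell (i ⊔ᶠ j) (c ⊓ d) i⊔j<c⊓d c⊓d≤b ]
    where
    c⊓d≤b : c ⊓ d ≤ b (i ⊔ᶠ j)
    c⊓d≤b with ⊔-sel i j
    ... | inj₁ i⊔j≡i = subst (λ k → c ⊓ d ≤ b k) (sym i⊔j≡i)
                         (ℕ.≤-trans (ℕ.m⊓n≤m c d) (recompute (c ℕ.≤? b i) c≤b))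
    ... | inj₂ i⊔j≡j = subst (λ k → c ⊓ d ≤ b k) (sym i⊔j≡j)
                         (ℕ.≤-trans (ℕ.m⊓n≤n c d) (recompute (d ℕ.≤? b j) d≤b))

  ⊑-refl : ∀ {u} → u ⊑ u
  ⊑-refl = IsPartialOrder.refl isPartialOrder

  join-supremum : ∀ u v → u ⊑ join u v × v ⊑ join u v × (∀ w → u ⊑ w → v ⊑ w → join u v ⊑ w)
  join-supremum ⊥₋    v  = ⊥₋≤ v , ⊑-refl , λ _ _ v⊑w → v⊑w
  join-supremum [ u ] ⊥₋ = ⊑-refl , ⊥₋≤ _ , λ _ u⊑w _ → u⊑w
  join-supremum [ cell i c _ _ ] [ cell j d _ _ ] =
    [ s≤s (x⊓y≤x i j) , ℕ.m≤m⊔n c d ] ,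
    [ s≤s (x⊓y≤y i j) , ℕ.m≤n⊔m c d ] ,
    λ { [ _ ] [ s≤s k≤i , c≤e ] [ s≤s k≤j , d≤e ] → [ s≤s (⊓-glb k≤i k≤j) , ℕ.⊔-lub c≤e d≤e ] }

  meet-infimum : ∀ u v → meet u v ⊑ u × meet u v ⊑ v × (∀ w → w ⊑ u → w ⊑ v → w ⊑ meet u v)
  meet-infimum ⊥₋    v  = ⊥₋≤ _ , ⊥₋≤ _ , λ _ w⊑⊥ _ → w⊑⊥
  meet-infimum [ u ] ⊥₋ = ⊥₋≤ _ , ⊥₋≤ _ , λ _ _ w⊑⊥ → w⊑⊥
  meet-infimum [ cell i c _ _ ] [ cell j d _ _ ] with pos (i ⊔ᶠ j) ℕ.≤? c ⊓ d
  ... | yes _ =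
    [ s≤s (x≤x⊔y i j) , ℕ.m⊓n≤m c d ] ,
    [ s≤s (x≤y⊔x i j) , ℕ.m⊓n≤n c d ] ,
    λ { ⊥₋ _ _ → ⊥₋≤ _
      ; [ _ ] [ s≤s i≤k , e≤c ] [ s≤s j≤k , e≤d ] → [ s≤s (⊔-lub i≤k j≤k) , ℕ.⊓-glb e≤c e≤d ] }
  ... | no i⊔j≮c⊓d =
    ⊥₋≤ _ , ⊥₋≤ _ ,
    λ { ⊥₋ _ _ → ⊥₋≤ _
      ; [ cell k e k<e _ ] [ s≤s i≤k , e≤c ] [ s≤s j≤k , e≤d ] → contradiction
          (ℕ.≤-trans (s≤s (⊔-lub i≤k j≤k))
            (ℕ.≤-trans (recompute (pos k ℕ.≤? e) k<e) (ℕ.⊓-glb e≤c e≤d)))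
          i⊔j≮c⊓d }

  F̂-isLattice : IsLattice _≡_ _⊑_ join meet
  F̂-isLattice = record
    { isPartialOrder = isPartialOrder
    ; supremum       = join-supremum
    ; infimum        = meet-infimum
    }

-- The root orders of types B and C

step-antitone : ∀ {a b} k → a ≤ b → step b k ℤ.≤ step a k
step-antitone {a} {b} k a≤b with b ℕ.<? k | a ℕ.<? k
... | yes b<k | _       = ℤ.≤-reflexive (trans (step-< b<k) (sym (step-< (ℕ.≤-<-trans a≤b b<k))))
... | no b≮k  | yes a<k = subst₂ ℤ._≤_ (sym (step-≥ (ℕ.≮⇒≥ b≮k))) (sym (step-< a<k)) (ℤ.+≤+ z≤n)
... | no b≮k  | no a≮k  = ℤ.≤-reflexive (trans (step-≥ (ℕ.≮⇒≥ b≮k)) (sym (step-≥ (ℕ.≮⇒≥ a≮k))))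

0≤step : ∀ a k → 0ℤ ℤ.≤ step a k
0≤step a k with a <ᵇ k
... | true  = ℤ.+≤+ z≤n
... | false = ℤ.+≤+ z≤n

step≤1 : ∀ a k → step a k ℤ.≤ 1ℤ
step≤1 a k with a <ᵇ k
... | true  = ℤ.+≤+ (s≤s z≤n)
... | false = ℤ.+≤+ z≤n

-- Coordinate k of the basis vector with index a, where a may be any natural number; indices from r
-- on give the zero vector in the first r coordinates.
Δstep : ℕ → ℕ → ℤ
Δstep a k = step a (suc k) ℤ.- step a k

Δstep-≥ : ∀ {a k r} → r ≤ a → k < r → Δstep a k ≡ 0ℤ
Δstep-≥ r≤a k<r = cong₂ ℤ._-_ (step-≥ (ℕ.≤-trans k<r r≤a)) (step-≥ (ℕ.≤-trans (ℕ.<⇒≤ k<r) r≤a))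

ε-Δstep : ∀ {r} (i k : Fin r) → ε i k ≡ Δstep (toℕ i) (toℕ k)
ε-Δstep i k with i Fin.≟ k
... | yes refl = sym (cong₂ ℤ._-_ (step-< (ℕ.n<1+n (toℕ i))) (step-≥ (ℕ.≤-refl {toℕ i})))
... | no i≢k with ℕ.<-cmp (toℕ i) (toℕ k)
...   | tri< i<k _ _ = sym (cong₂ ℤ._-_ (step-< (ℕ.m<n⇒m<1+n i<k)) (step-< i<k))
...   | tri≈ _ i≡k _ = contradiction (Fin.toℕ-injective i≡k) i≢k
...   | tri> _ _ k<i = sym (cong₂ ℤ._-_ (step-≥ k<i) (step-≥ (ℕ.<⇒≤ k<i)))

ε-suc : ∀ {r} (i k : Fin r) → ε (Fin.suc i) (Fin.suc k) ≡ ε i k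
ε-suc i k = trans (ε-Δstep (Fin.suc i) (Fin.suc k)) (sym (ε-Δstep i k))

simple-suc-zero : ∀ T {r} (i : Fin (suc r)) → toVector T (simple (Fin.suc i)) Fin.zero ≡ 0ℤ
simple-suc-zero T i with simple i
... | ε-ε _ _ _ = refl
... | ε+ε _ _ _ = refl
... | axis _    = ℤ.*-zeroʳ (scale T)

simple-suc-suc : ∀ T {r} (i k : Fin (suc r)) →
                 toVector T (simple (Fin.suc i)) (Fin.suc k) ≡ toVector T (simple i) k
simple-suc-suc T i k with simple i
... | ε-ε j l _ = cong₂ ℤ._-_ (ε-suc j k) (ε-suc l k)
... | ε+ε j l _ = cong₂ ℤ._+_ (ε-suc j k) (ε-suc l k)
... | axis j    = cong (ℤ._*_ (scale T)) (ε-suc j k)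

-- The sum of the first k coordinates of Σ_i n_i α_i.
partialSum : RootType → ∀ {r} → (Fin r → ℕ) → ℕ → ℤ
partialSum T                 n zero          = 0ℤ
partialSum T {zero}          n (suc k)       = 0ℤ
partialSum T {suc zero}      n (suc k)       = scale T ℤ.* ℤ.+ n Fin.zero
partialSum T {suc (suc r)}   n (suc zero)    = ℤ.+ n Fin.zero
partialSum T {suc (suc r)}   n (suc (suc k)) = partialSum T (n ∘ Fin.suc) (suc k)

-- Induction on the rank: beyond the first, the simple roots are those of smaller rank shifted by
-- one, and the first adds only `n₀` at coordinate 0 and its negative at coordinate 1.
∑-simple : ∀ T {r} (n : Fin r → ℕ) k →
           ∑ (λ i → ℤ.+ n i ℤ.* toVector T (simple i) k) ≡
           partialSum T n (suc (toℕ k)) ℤ.- partialSum T n (toℕ k)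
∑-simple T {suc zero} n Fin.zero = lemma (ℤ.+ n Fin.zero) (scale T)
  where
  lemma : ∀ a s → a ℤ.* (s ℤ.* 1ℤ) ℤ.+ 0ℤ ≡ s ℤ.* a ℤ.- 0ℤ
  lemma = solve-∀
∑-simple T {suc (suc r)} n Fin.zero = begin
  n₀ ℤ.* 1ℤ ℤ.+ ∑ (λ i → ℤ.+ n (Fin.suc i) ℤ.* toVector T (simple (Fin.suc i)) Fin.zero)
    ≡⟨ cong (ℤ._+_ (n₀ ℤ.* 1ℤ)) (sum-cong-≗ (λ i → trans
         (cong (ℤ._*_ (ℤ.+ n (Fin.suc i))) (simple-suc-zero T i)) (ℤ.*-zeroʳ (ℤ.+ n (Fin.suc i))))) ⟩
  n₀ ℤ.* 1ℤ ℤ.+ ∑ {suc r} (λ _ → 0ℤ)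
    ≡⟨ cong (ℤ._+_ (n₀ ℤ.* 1ℤ)) (sum-replicate-zero (suc r)) ⟩
  n₀ ℤ.* 1ℤ ℤ.+ 0ℤ
    ≡⟨ cong (ℤ._+ 0ℤ) (ℤ.*-identityʳ n₀) ⟩
  n₀ ℤ.- 0ℤ ∎
  where
  open ≡-Reasoning
  n₀ = ℤ.+ n Fin.zero
∑-simple T {suc (suc r)} n (Fin.suc k) = begin
  n₀ ℤ.* (0ℤ ℤ.- ε (Fin.suc Fin.zero) (Fin.suc k))
    ℤ.+ ∑ (λ i → ℤ.+ n (Fin.suc i) ℤ.* toVector T (simple (Fin.suc i)) (Fin.suc k))
    ≡⟨ cong₂ (λ x s → n₀ ℤ.* (0ℤ ℤ.- x) ℤ.+ s) (ε-suc Fin.zero k)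
         (sum-cong-≗ (λ i → cong (ℤ._*_ (ℤ.+ n (Fin.suc i))) (simple-suc-suc T i k))) ⟩
  n₀ ℤ.* (0ℤ ℤ.- ε Fin.zero k) ℤ.+ ∑ (λ i → ℤ.+ n (Fin.suc i) ℤ.* toVector T (simple i) k)
    ≡⟨ cong (ℤ._+_ (n₀ ℤ.* (0ℤ ℤ.- ε Fin.zero k))) (∑-simple T (n ∘ Fin.suc) k) ⟩
  n₀ ℤ.* (0ℤ ℤ.- ε Fin.zero k)
    ℤ.+ (partialSum T (n ∘ Fin.suc) (suc (toℕ k)) ℤ.- partialSum T (n ∘ Fin.suc) (toℕ k))
    ≡⟨ telescope k ⟩
  partialSum T n (suc (suc (toℕ k))) ℤ.- partialSum T n (suc (toℕ k)) ∎
  where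
  open ≡-Reasoning
  n₀ = ℤ.+ n Fin.zero

  first : ∀ a s → a ℤ.* -1ℤ ℤ.+ (s ℤ.- 0ℤ) ≡ s ℤ.- a
  first = solve-∀

  later : ∀ a s → a ℤ.* 0ℤ ℤ.+ s ≡ s
  later = solve-∀

  telescope : ∀ k → n₀ ℤ.* (0ℤ ℤ.- ε Fin.zero k)
    ℤ.+ (partialSum T (n ∘ Fin.suc) (suc (toℕ k)) ℤ.- partialSum T (n ∘ Fin.suc) (toℕ k))
    ≡ partialSum T n (suc (suc (toℕ k))) ℤ.- partialSum T n (suc (toℕ k))
  telescope Fin.zero    = first n₀ (partialSum T (n ∘ Fin.suc) 1)
  telescope (Fin.suc k) = later n₀ (partialSum T n (suc (suc (suc (toℕ k)))) ℤ.- partialSum T n (suc (suc (toℕ k))))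

0≤scale* : ∀ T n → 0ℤ ℤ.≤ scale T ℤ.* ℤ.+ n
0≤scale* B n = subst (0ℤ ℤ.≤_) (ℤ.pos-* 1 n) (ℤ.+≤+ z≤n)
0≤scale* C n = subst (0ℤ ℤ.≤_) (ℤ.pos-* 2 n) (ℤ.+≤+ z≤n)

0≤partialSum : ∀ T {r} (n : Fin r → ℕ) k → 0ℤ ℤ.≤ partialSum T n k
0≤partialSum T                 n zero          = ℤ.+≤+ z≤n
0≤partialSum T {zero}          n (suc k)       = ℤ.+≤+ z≤n
0≤partialSum T {suc zero}      n (suc k)       = 0≤scale* T (n Fin.zero)
0≤partialSum T {suc (suc r)}   n (suc zero)    = ℤ.+≤+ z≤n
0≤partialSum T {suc (suc r)}   n (suc (suc k)) = 0≤partialSum T (n ∘ Fin.suc) (suc k)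

-- The values at 1, ..., r - 1 are themselves coefficients and hence free; the value at r is
-- `scale T` times a coefficient, whence the divisibility hypothesis.
partialSum-surjective : ∀ T {r} (d : ℕ → ℕ) q → ℤ.+ d r ≡ scale T ℤ.* ℤ.+ q →
                        ∃ λ (n : Fin r → ℕ) → ∀ {k} → k < r → partialSum T n (suc k) ≡ ℤ.+ d (suc k)
partialSum-surjective T {zero}        d q _ = (λ ()) , λ ()
partialSum-surjective T {suc zero}    d q e = (λ _ → q) , λ { (s≤s z≤n) → sym e }
partialSum-surjective T {suc (suc r)} d q e with partialSum-surjective T {suc r} (d ∘ suc) q e
... | n , n-sums = (d 1 Vector.∷ n) , λ { {zero} _ → refl ; {suc k} (s≤s k<r) → n-sums k<r }

ε-ε-≡ : ∀ {r} {i j j′ : Fin r} .{i<j : i Fin.< j} .{i<j′ : i Fin.< j′} → j ≡ j′ → ε-ε i j i<j ≡ ε-ε i j′ i<j′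
ε-ε-≡ refl = refl

ε+ε-≡ : ∀ {r} {i j j′ : Fin r} .{i<j : i Fin.< j} .{i<j′ : i Fin.< j′} → j ≡ j′ → ε+ε i j i<j ≡ ε+ε i j′ i<j′
ε+ε-≡ refl = refl

-- Cells of the balanced diagram as positive roots

module _ (T : RootType) (r : ℕ) where

  -- Column c ≥ r of row i stands for ε_i + ε_j, where j, counted from 0, is mirror c; it
  -- degenerates to the root on axis i when j = r (type B) or j = i (type C).
  mirrorSum : RootType → ℕ
  mirrorSum B = 2 * r
  mirrorSum C = 2 * r ∸ 1

  mirror : ℕ → ℕ
  mirror c = mirrorSum T ∸ c

  mirrorSum≤2r : ∀ T → mirrorSum T ≤ 2 * r
  mirrorSum≤2r B = ℕ.≤-refl
  mirrorSum≤2r C = ℕ.m∸n≤m (2 * r) 1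

  col+pos≤2r : ∀ {c} (i : Fin r) → c ≤ balanced r i → c + pos i ≤ 2 * r
  col+pos≤2r {c} i = ℕ.m≤o∸n⇒m+n≤o c (ℕ.≤-trans (Fin.toℕ<n i) (ℕ.m≤m+n r (r + 0)))

  module _ where
    open ℕ.≤-Reasoning

    -- At most one of c and `mirror c` is thus a coordinate index, which lets a single formula for
    -- `profile` cover differences and sums.
    r≤mirror : ∀ {c} → c < r → r ≤ mirror c
    r≤mirror {c} c<r = ℕ.m+n≤o⇒m≤o∸n r (bound T)
      where
      r+c<2r : suc (r + c) ≤ 2 * r
      r+c<2r = begin
        suc (r + c) ≡⟨ ℕ.+-suc r c ⟨
        r + suc c   ≤⟨ ℕ.+-monoʳ-≤ r c<r ⟩
        r + r       ≡⟨ cong (r +_) (ℕ.+-identityʳ r) ⟨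
        2 * r       ∎
      bound : ∀ T → r + c ≤ mirrorSum T
      bound B = ℕ.<⇒≤ r+c<2r
      bound C = ℕ.∸-monoˡ-≤ 1 r+c<2r

    row+col≤mirrorSum : ∀ T {c} (i : Fin r) → c ≤ balanced r i → toℕ i + c ≤ mirrorSum T
    row+col≤mirrorSum T {c} i c≤b = bound T
      where
      i+c<2r : suc (toℕ i + c) ≤ 2 * r
      i+c<2r = ℕ.≤-trans (ℕ.≤-reflexive (ℕ.+-comm (pos i) c)) (col+pos≤2r i c≤b)
      bound : ∀ T → toℕ i + c ≤ mirrorSum T
      bound B = ℕ.<⇒≤ i+c<2r
      bound C = ℕ.∸-monoˡ-≤ 1 i+c<2r

    row≤mirror : ∀ {c} (i : Fin r) → c ≤ balanced r i → toℕ i ≤ mirror c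
    row≤mirror i c≤b = ℕ.m+n≤o⇒m≤o∸n (toℕ i) (row+col≤mirrorSum T i c≤b)

    col≤mirrorSum : ∀ {c} (i : Fin r) → c ≤ balanced r i → c ≤ mirrorSum T
    col≤mirrorSum {c} i c≤b = ℕ.≤-trans (ℕ.m≤n+m c (toℕ i)) (row+col≤mirrorSum T i c≤b)

    mirror≤r : ∀ {c} → r ≤ c → mirror c ≤ r
    mirror≤r {c} r≤c = begin
      mirrorSum T ∸ c ≤⟨ ℕ.∸-mono (mirrorSum≤2r T) r≤c ⟩
      2 * r ∸ r       ≡⟨ ℕ.m+n∸m≡n r (r + 0) ⟩
      r + 0           ≡⟨ ℕ.+-identityʳ r ⟩
      r               ∎

  -- The sum of the first k coordinates of the root in row i + 1 and column c.  A simple root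
  -- affects a single such sum, so the root order compares profiles pointwise.
  profile : ℕ → ℕ → ℕ → ℤ
  profile i c k = step i k ℤ.- step c k ℤ.+ step (mirror c) k

  Δprofile : ∀ i c k → profile i c (suc k) ℤ.- profile i c k ≡ Δstep i k ℤ.- Δstep c k ℤ.+ Δstep (mirror c) k
  Δprofile i c k = rearrange (step i (suc k)) (step c (suc k)) (step (mirror c) (suc k)) _ _ _
    where
    rearrange : ∀ a b c d e f → a ℤ.- b ℤ.+ c ℤ.- (d ℤ.- e ℤ.+ f) ≡ (a ℤ.- d) ℤ.- (b ℤ.- e) ℤ.+ (c ℤ.- f)
    rearrange = solve-∀

  combine-mono : ∀ {a a′ b b′ c c′} → a ℤ.≤ a′ → b′ ℤ.≤ b → c ℤ.≤ c′ → a ℤ.- b ℤ.+ c ℤ.≤ a′ ℤ.- b′ ℤ.+ c′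
  combine-mono a≤ b≥ c≤ = ℤ.+-mono-≤ (ℤ.+-mono-≤ a≤ (ℤ.neg-mono-≤ b≥)) c≤

  -- `mirror` reverses the order of columns, so the reflected step also increases with the column.
  profile-mono : ∀ {i j c d} k → j ≤ i → c ≤ d → profile i c k ℤ.≤ profile j d k
  profile-mono k j≤i c≤d = combine-mono (step-antitone k j≤i) (step-antitone k c≤d)
                             (step-antitone k (ℕ.∸-monoʳ-≤ (mirrorSum T) c≤d))

  module _ {i j : Fin r} {c d} (i<c : toℕ i < c) (c≤b : c ≤ balanced r i)
           (j<d : toℕ j < d) (d≤b : d ≤ balanced r j)
           (profile≤ : ∀ {k} → k ≤ r → profile (toℕ i) c k ℤ.≤ profile (toℕ j) d k) where

    private
      witness : ∀ {k x x′ y y′ z z′} → k ≤ r →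
                x ℤ.≤ step (toℕ i) k → step c k ℤ.≤ y → z ℤ.≤ step (mirror c) k →
                step (toℕ j) k ℤ.≤ x′ → y′ ℤ.≤ step d k → step (mirror d) k ℤ.≤ z′ →
                x ℤ.- y ℤ.+ z ℤ.≤ x′ ℤ.- y′ ℤ.+ z′
      witness k≤r x≤ y≥ z≤ x′≥ y′≤ z′≥ = ℤ.≤-trans (combine-mono x≤ y≥ z≤)
        (ℤ.≤-trans (profile≤ k≤r) (combine-mono x′≥ y′≤ z′≥))

      one : ∀ {a k} → a < k → 1ℤ ℤ.≤ step a k
      one a<k = ℤ.≤-reflexive (sym (step-< a<k))

      none : ∀ {a k} → k ≤ a → step a k ℤ.≤ 0ℤ
      none k≤a = ℤ.≤-reflexive (step-≥ k≤a)

    -- If row i came before row j, then at `pos i` the first profile would be at least 1, while no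
    -- step of the second has begun.
    profile-reflects-row : toℕ j ≤ toℕ i
    profile-reflects-row = ℕ.≮⇒≥ λ i<j → absurd (witness (Fin.toℕ<n i)
      (one (ℕ.n<1+n (toℕ i))) (none i<c) (0≤step (mirror c) (pos i))
      (none i<j) (0≤step d (pos i)) (none (ℕ.≤-trans i<j (row≤mirror j d≤b))))
      where
      absurd : ¬ (1ℤ ℤ.≤ 0ℤ)
      absurd (ℤ.+≤+ ())

    profile-reflects-col : c ≤ d
    profile-reflects-col = ℕ.≮⇒≥ λ d<c → absurd d<c (d ℕ.<? r)
      where
      absurd : d < c → ¬ Dec (d < r)
      -- At this index both d and i are passed but c is not, so the profiles would give 1 ≤ 0.
      absurd d<c (yes d<r) with witness {k = suc (d ⊔ toℕ i)} (ℕ.⊔-lub d<r (Fin.toℕ<n i))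
        (one (s≤s (ℕ.m≤n⊔m d (toℕ i)))) (none (ℕ.⊔-lub d<c i<c)) (0≤step (mirror c) (suc (d ⊔ toℕ i)))
        (step≤1 (toℕ j) (suc (d ⊔ toℕ i))) (one (s≤s (ℕ.m≤m⊔n d (toℕ i))))
        (none (ℕ.≤-trans (ℕ.⊔-lub d<r (Fin.toℕ<n i)) (r≤mirror d<r)))
      ... | ℤ.+≤+ ()
      -- Now both columns are reflected. Just after `mirror c` the first profile is 2, while the
      -- second has not reached `mirror d` and is at most 1.
      absurd d<c (no d≮r) with witness {k = suc (mirror c)} (ℕ.≤-trans mc<md (mirror≤r r≤d))
        (one (s≤s (row≤mirror i c≤b)))
        (none (ℕ.≤-trans (ℕ.≤-trans mc<md (mirror≤r r≤d)) (ℕ.≤-trans r≤d (ℕ.<⇒≤ d<c))))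
        (one (ℕ.n<1+n (mirror c)))
        (step≤1 (toℕ j) (suc (mirror c))) (0≤step d (suc (mirror c))) (none mc<md)
        where
        r≤d = ℕ.≮⇒≥ d≮r
        mc<md : mirror c < mirror d
        mc<md = ℕ.∸-monoʳ-< d<c (col≤mirrorSum i c≤b)
      ... | ℤ.+≤+ (s≤s ())

  -- Column c < r of row i stands for ε_i - ε_j, where j, counted from 0, is c.
  classify : ∀ (i : Fin r) c → .(toℕ i < c) → Dec (c < r) → Dec (toℕ i < mirror c) → Dec (mirror c < r) →
             PositiveRoot r
  classify i c i<c (yes c<r) _         _         = ε-ε i (fromℕ< c<r) (subst (toℕ i <_) (sym (Fin.toℕ-fromℕ< c<r)) i<c)
  classify i c _   (no _)    (yes i<t) (yes t<r) = ε+ε i (fromℕ< t<r) (subst (toℕ i <_) (sym (Fin.toℕ-fromℕ< t<r)) i<t)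
  classify i c _   (no _)    (yes _)   (no _)    = axis i
  classify i c _   (no _)    (no _)    _         = axis i

  toRoot : Cell (balanced r) → PositiveRoot r
  toRoot (cell i c i<c _) = classify i c i<c (c ℕ.<? r) (toℕ i ℕ.<? mirror c) (mirror c ℕ.<? r)

  -- T is a module parameter, so case splits on it go through an equation T ≡ T′.
  mirror-B : T ≡ B → ∀ {c} (i : Fin r) → c ≤ balanced r i → toℕ i < mirror c
  mirror-B refl {c} i c≤b = ℕ.m+n≤o⇒m≤o∸n (pos i) (subst (_≤ 2 * r) (ℕ.+-comm c (pos i)) (col+pos≤2r i c≤b))

  mirror-C : T ≡ C → ∀ {c} → Fin r → r ≤ c → mirror c < r
  mirror-C refl {c} i r≤c = ℕ.≤-<-trans (ℕ.∸-monoʳ-≤ (2 * r ∸ 1) r≤c)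
    (ℕ.≤-trans (s≤s (ℕ.≤-reflexive 2r-1-r≡r-1)) (ℕ.≤-reflexive (ℕ.m+[n∸m]≡n {1} 1≤r)))
    where
    1≤r : 1 ≤ r
    1≤r = ℕ.≤-trans (s≤s z≤n) (Fin.toℕ<n i)
    open ≡-Reasoning
    2r-1-r≡r-1 : 2 * r ∸ 1 ∸ r ≡ r ∸ 1
    2r-1-r≡r-1 = begin
      2 * r ∸ 1 ∸ r   ≡⟨ ℕ.∸-+-assoc (2 * r) 1 r ⟩
      2 * r ∸ (1 + r) ≡⟨ cong (2 * r ∸_) (ℕ.+-comm 1 r) ⟩
      2 * r ∸ (r + 1) ≡⟨ ℕ.∸-+-assoc (2 * r) r 1 ⟨
      2 * r ∸ r ∸ 1   ≡⟨ cong (_∸ 1) (trans (ℕ.m+n∸m≡n r (r + 0)) (ℕ.+-identityʳ r)) ⟩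
      r ∸ 1           ∎

  -- In type B the reflected index is beyond i, so it must be out of range and contributes zero. In
  -- type C it is in range and at least i, so it equals i and doubles the basis vector.
  Δstep-mirror : ∀ T′ → T ≡ T′ → ∀ {c} (i : Fin r) (k : Fin r) → c ≤ balanced r i → r ≤ c →
                 ¬ (toℕ i < mirror c × mirror c < r) →
                 scale T′ ℤ.* Δstep (toℕ i) (toℕ k) ≡ Δstep (toℕ i) (toℕ k) ℤ.+ Δstep (mirror c) (toℕ k)
  Δstep-mirror B refl {c} i k c≤b r≤c not = trans (ℤ.*-identityˡ Δi) (trans (sym (ℤ.+-identityʳ Δi))
    (cong (ℤ._+_ Δi) (sym (Δstep-≥ (ℕ.≮⇒≥ (λ t<r → not (mirror-B refl i c≤b , t<r))) (Fin.toℕ<n k)))))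
    where Δi = Δstep (toℕ i) (toℕ k)
  Δstep-mirror C refl {c} i k c≤b r≤c not = trans (double Δi)
    (cong (λ t → Δi ℤ.+ Δstep t (toℕ k)) (ℕ.≤-antisym (row≤mirror i c≤b)
      (ℕ.≮⇒≥ (λ i<t → not (i<t , mirror-C refl i r≤c)))))
    where
    Δi = Δstep (toℕ i) (toℕ k)
    double : ∀ a → ℤ.+ 2 ℤ.* a ≡ a ℤ.+ a
    double = solve-∀

  toVector-classify : ∀ i c .(i<c : toℕ i < c) (c≤b : c ≤ balanced r i) c<?r i<?t t<?r k →
                      toVector T (classify i c i<c c<?r i<?t t<?r) k ≡
                      Δstep (toℕ i) (toℕ k) ℤ.- Δstep c (toℕ k) ℤ.+ Δstep (mirror c) (toℕ k)
  toVector-classify i c _ c≤b (yes c<r) _ _ k = begin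
    ε i k ℤ.- ε (fromℕ< c<r) k
      ≡⟨ cong₂ ℤ._-_ (ε-Δstep i k) (trans (ε-Δstep (fromℕ< c<r) k) (cong (λ x → Δstep x (toℕ k)) (Fin.toℕ-fromℕ< c<r))) ⟩
    Δstep (toℕ i) (toℕ k) ℤ.- Δstep c (toℕ k)
      ≡⟨ ℤ.+-identityʳ _ ⟨
    Δstep (toℕ i) (toℕ k) ℤ.- Δstep c (toℕ k) ℤ.+ 0ℤ
      ≡⟨ cong (ℤ._+_ (Δstep (toℕ i) (toℕ k) ℤ.- Δstep c (toℕ k))) (Δstep-≥ (r≤mirror c<r) (Fin.toℕ<n k)) ⟨
    Δstep (toℕ i) (toℕ k) ℤ.- Δstep c (toℕ k) ℤ.+ Δstep (mirror c) (toℕ k) ∎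
    where open ≡-Reasoning
  toVector-classify i c i<c c≤b (no c≮r) i<?t t<?r k = trans (without-c i<?t t<?r)
    (cong (ℤ._+ Δstep (mirror c) (toℕ k)) (trans (sym (ℤ.+-identityʳ (Δstep (toℕ i) (toℕ k))))
      (cong (ℤ._-_ (Δstep (toℕ i) (toℕ k))) (sym (Δstep-≥ r≤c (Fin.toℕ<n k))))))
    where
    r≤c = ℕ.≮⇒≥ c≮r

    on-axis : ¬ (toℕ i < mirror c × mirror c < r) →
              scale T ℤ.* ε i k ≡ Δstep (toℕ i) (toℕ k) ℤ.+ Δstep (mirror c) (toℕ k)
    on-axis not = trans (cong (ℤ._*_ (scale T)) (ε-Δstep i k)) (Δstep-mirror T refl i k c≤b r≤c not)

    without-c : ∀ i<?t t<?r → toVector T (classify i c i<c (no c≮r) i<?t t<?r) k ≡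
                              Δstep (toℕ i) (toℕ k) ℤ.+ Δstep (mirror c) (toℕ k)
    without-c (yes i<t) (yes t<r) = cong₂ ℤ._+_ (ε-Δstep i k)
      (trans (ε-Δstep (fromℕ< t<r) k) (cong (λ x → Δstep x (toℕ k)) (Fin.toℕ-fromℕ< t<r)))
    without-c (yes i<t) (no t≮r)  = on-axis (t≮r ∘ proj₂)
    without-c (no i≮t)  _         = on-axis (i≮t ∘ proj₁)

  profileOf : Cell (balanced r) → ℕ → ℤ
  profileOf u = profile (toℕ (Cell.row u)) (Cell.col u)

  toVector-toRoot : ∀ u k → toVector T (toRoot u) k ≡ profileOf u (suc (toℕ k)) ℤ.- profileOf u (toℕ k)
  toVector-toRoot (cell i c i<c c≤b) k = trans
    (toVector-classify i c i<c (recompute (c ℕ.≤? balanced r i) c≤b)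
      (c ℕ.<? r) (toℕ i ℕ.<? mirror c) (mirror c ℕ.<? r) k)
    (sym (Δprofile (toℕ i) c (toℕ k)))

  -- In type C exactly one of c and `mirror c` is less than r, so the last two steps make the total
  -- even.
  profile-C : T ≡ C → ∀ (i : Fin r) c → profile (toℕ i) c r ≡ ℤ.+ 2 ℤ.* (1ℤ ℤ.- step c r)
  profile-C T≡C i c with c ℕ.<? r
  ... | yes c<r = trans
    (cong₂ ℤ._+_ (cong₂ ℤ._-_ (step-< (Fin.toℕ<n i)) (step-< c<r)) (step-≥ (r≤mirror c<r)))
    (cong (λ s → ℤ.+ 2 ℤ.* (1ℤ ℤ.- s)) (sym (step-< c<r)))
  ... | no c≮r  = trans
    (cong₂ ℤ._+_ (cong₂ ℤ._-_ (step-< (Fin.toℕ<n i)) (step-≥ (ℕ.≮⇒≥ c≮r))) (step-< (mirror-C T≡C i (ℕ.≮⇒≥ c≮r))))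
    (cong (λ s → ℤ.+ 2 ℤ.* (1ℤ ℤ.- s)) (sym (step-≥ (ℕ.≮⇒≥ c≮r))))

  -- Supplies the divisibility at index r that `partialSum-surjective` asks for.
  profile-difference-scale : ∀ T′ → T ≡ T′ → ∀ {u v : Cell (balanced r)} → u ≤ᶠ v →
                             ∃ λ q → profileOf v r ℤ.- profileOf u r ≡ scale T′ ℤ.* ℤ.+ q
  profile-difference-scale B refl {u} {v} (s≤s j≤i , c≤d) = ℤ.∣ d ∣ , (begin
    d               ≡⟨ ℤ.0≤i⇒+∣i∣≡i (ℤ.i≤j⇒0≤j-i (profile-mono r j≤i c≤d)) ⟨
    ℤ.+ ℤ.∣ d ∣      ≡⟨ ℤ.*-identityˡ _ ⟨
    1ℤ ℤ.* ℤ.+ ℤ.∣ d ∣ ∎)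
    where
    open ≡-Reasoning
    d = profileOf v r ℤ.- profileOf u r
  profile-difference-scale C refl {u@(cell i c _ _)} {v@(cell j e _ _)} (_ , c≤e) = ℤ.∣ d ∣ , (begin
    profileOf v r ℤ.- profileOf u r
      ≡⟨ cong₂ ℤ._-_ (profile-C refl j e) (profile-C refl i c) ⟩
    ℤ.+ 2 ℤ.* (1ℤ ℤ.- step e r) ℤ.- ℤ.+ 2 ℤ.* (1ℤ ℤ.- step c r)
      ≡⟨ factor (step e r) (step c r) ⟩
    ℤ.+ 2 ℤ.* d
      ≡⟨ cong (ℤ._*_ (ℤ.+ 2)) (ℤ.0≤i⇒+∣i∣≡i (ℤ.i≤j⇒0≤j-i (step-antitone r c≤e))) ⟨
    ℤ.+ 2 ℤ.* ℤ.+ ℤ.∣ d ∣ ∎)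
    where
    open ≡-Reasoning
    d = step c r ℤ.- step e r
    factor : ∀ a b → ℤ.+ 2 ℤ.* (1ℤ ℤ.- a) ℤ.- ℤ.+ 2 ℤ.* (1ℤ ℤ.- b) ≡ ℤ.+ 2 ℤ.* (b ℤ.- a)
    factor = solve-∀

  toRoot-mono : ∀ {u v} → u ≤ᶠ v → RootOrder T r (toRoot u) (toRoot v)
  toRoot-mono {u} {v} u≤v@(s≤s j≤i , c≤d) = n , λ k → begin
    toVector T (toRoot v) k
      ≡⟨ toVector-toRoot v k ⟩
    Pv (suc (toℕ k)) ℤ.- Pv (toℕ k)
      ≡⟨ regroup (Pv (suc (toℕ k))) (Pv (toℕ k)) (Pu (suc (toℕ k))) (Pu (toℕ k)) ⟩
    Pu (suc (toℕ k)) ℤ.- Pu (toℕ k) ℤ.+ (Pv (suc (toℕ k)) ℤ.- Pu (suc (toℕ k)) ℤ.- (Pv (toℕ k) ℤ.- Pu (toℕ k)))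
      ≡⟨ cong₂ ℤ._+_ (toVector-toRoot u k)
           (cong₂ ℤ._-_ (n-sums (suc (toℕ k)) (Fin.toℕ<n k)) (n-sums (toℕ k) (ℕ.<⇒≤ (Fin.toℕ<n k)))) ⟨
    toVector T (toRoot u) k ℤ.+ (partialSum T n (suc (toℕ k)) ℤ.- partialSum T n (toℕ k))
      ≡⟨ cong (ℤ._+_ (toVector T (toRoot u) k)) (∑-simple T n k) ⟨
    toVector T (toRoot u) k ℤ.+ ∑ (λ i → ℤ.+ n i ℤ.* toVector T (simple i) k) ∎
    where
    open ≡-Reasoning
    Pu = profileOf u
    Pv = profileOf v

    d : ℕ → ℕ
    d k = ℤ.∣ Pv k ℤ.- Pu k ∣

    +d : ∀ k → ℤ.+ d k ≡ Pv k ℤ.- Pu k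
    +d k = ℤ.0≤i⇒+∣i∣≡i (ℤ.i≤j⇒0≤j-i (profile-mono k j≤i c≤d))

    scaled = profile-difference-scale T refl {u} {v} u≤v
    coefficients = partialSum-surjective T {r} d (proj₁ scaled) (trans (+d r) (proj₂ scaled))
    n = proj₁ coefficients

    n-sums : ∀ k → k ≤ r → partialSum T n k ≡ Pv k ℤ.- Pu k
    n-sums zero    _   = refl
    n-sums (suc k) k<r = trans (proj₂ coefficients k<r) (+d (suc k))

    regroup : ∀ a b c d → a ℤ.- b ≡ c ℤ.- d ℤ.+ (a ℤ.- c ℤ.- (b ℤ.- d))
    regroup = solve-∀

  toRoot-cancel : ∀ {u v} → RootOrder T r (toRoot u) (toRoot v) → u ≤ᶠ v
  toRoot-cancel {u@(cell i c i<c c≤b)} {v@(cell j d j<d d≤b)} (n , β≡α+n) =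
    s≤s (profile-reflects-row i<c′ c≤b′ j<d′ d≤b′ (profile≤ _)) ,
    profile-reflects-col i<c′ c≤b′ j<d′ d≤b′ (profile≤ _)
    where
    open ≡-Reasoning
    i<c′ = recompute (pos i ℕ.≤? c) i<c
    c≤b′ = recompute (c ℕ.≤? balanced r i) c≤b
    j<d′ = recompute (pos j ℕ.≤? d) j<d
    d≤b′ = recompute (d ℕ.≤? balanced r j) d≤b
    Pu = profileOf u
    Pv = profileOf v
    N  = partialSum T n

    increment : ∀ (k : Fin r) → Pv (suc (toℕ k)) ℤ.- Pv (toℕ k) ≡
                Pu (suc (toℕ k)) ℤ.- Pu (toℕ k) ℤ.+ (N (suc (toℕ k)) ℤ.- N (toℕ k))
    increment k = begin
      Pv (suc (toℕ k)) ℤ.- Pv (toℕ k)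
        ≡⟨ toVector-toRoot v k ⟨
      toVector T (toRoot v) k
        ≡⟨ β≡α+n k ⟩
      toVector T (toRoot u) k ℤ.+ ∑ (λ i → ℤ.+ n i ℤ.* toVector T (simple i) k)
        ≡⟨ cong₂ ℤ._+_ (toVector-toRoot u k) (∑-simple T n k) ⟩
      Pu (suc (toℕ k)) ℤ.- Pu (toℕ k) ℤ.+ (N (suc (toℕ k)) ℤ.- N (toℕ k)) ∎

    -- All three functions vanish at 0, so the coordinatewise equations add up; nonnegativity of `N`
    -- then orders the profiles.
    profile≡ : ∀ k → k ≤ r → Pv k ≡ Pu k ℤ.+ N k
    profile≡ zero    _   = refl
    profile≡ (suc k) k<r = begin
      Pv (suc k)
        ≡⟨ split (Pv (suc k)) (Pv k) ⟩
      Pv (suc k) ℤ.- Pv k ℤ.+ Pv k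
        ≡⟨ cong₂ ℤ._+_ (subst (λ l → Pv (suc l) ℤ.- Pv l ≡ Pu (suc l) ℤ.- Pu l ℤ.+ (N (suc l) ℤ.- N l))
                         (Fin.toℕ-fromℕ< k<r) (increment (fromℕ< k<r)))
                       (profile≡ k (ℕ.<⇒≤ k<r)) ⟩
      Pu (suc k) ℤ.- Pu k ℤ.+ (N (suc k) ℤ.- N k) ℤ.+ (Pu k ℤ.+ N k)
        ≡⟨ merge (Pu (suc k)) (Pu k) (N (suc k)) (N k) ⟩
      Pu (suc k) ℤ.+ N (suc k) ∎
      where
      split : ∀ a b → a ≡ a ℤ.- b ℤ.+ b
      split = solve-∀
      merge : ∀ a b c d → a ℤ.- b ℤ.+ (c ℤ.- d) ℤ.+ (b ℤ.+ d) ≡ a ℤ.+ c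
      merge = solve-∀

    profile≤ : ∀ k → k ≤ r → Pu k ℤ.≤ Pv k
    profile≤ k k≤r = subst₂ ℤ._≤_ (ℤ.+-identityʳ (Pu k)) (sym (profile≡ k k≤r))
      (ℤ.+-monoʳ-≤ (Pu k) (0≤partialSum T n k))

  toRoot-surjective : ∀ α → ∃ λ u → toRoot u ≡ α
  toRoot-surjective (ε-ε i j i<j) = cell i (toℕ j) i<j (ℕ.≤-trans (ℕ.<⇒≤ (Fin.toℕ<n j)) (r≤balanced i)) ,
    found (toℕ j ℕ.<? r) (toℕ i ℕ.<? mirror (toℕ j)) (mirror (toℕ j) ℕ.<? r)
    where
    found : ∀ p q s → classify i (toℕ j) i<j p q s ≡ ε-ε i j i<j
    found (yes j<r) _ _ = ε-ε-≡ (Fin.fromℕ<-toℕ j j<r)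
    found (no j≮r)  _ _ = contradiction (Fin.toℕ<n j) j≮r
  toRoot-surjective (ε+ε i j i<j) = cell i (mirror (toℕ j)) i<c
      (ℕ.∸-mono (mirrorSum≤2r T) i<j) ,
    found (mirror (toℕ j) ℕ.<? r) (toℕ i ℕ.<? mirror (mirror (toℕ j))) (mirror (mirror (toℕ j)) ℕ.<? r)
    where
    i<c : toℕ i < mirror (toℕ j)
    i<c = ℕ.≤-trans (Fin.toℕ<n i) (r≤mirror (Fin.toℕ<n j))

    mirror²≡ : mirror (mirror (toℕ j)) ≡ toℕ j
    mirror²≡ = ℕ.m∸[m∸n]≡n (col≤mirrorSum j (ℕ.≤-trans (ℕ.<⇒≤ (Fin.toℕ<n j)) (r≤balanced j)))

    found : ∀ p q s → classify i (mirror (toℕ j)) i<c p q s ≡ ε+ε i j i<j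
    found (yes c<r) _ _ = contradiction c<r (ℕ.≤⇒≯ (r≤mirror (Fin.toℕ<n j)))
    found (no _) (yes _) (yes t<r) = ε+ε-≡ (Fin.toℕ-injective (trans (Fin.toℕ-fromℕ< t<r) mirror²≡))
    found (no _) (no i≮t) _ = contradiction (subst (toℕ i <_) (sym mirror²≡) (recompute (toℕ i ℕ.<? toℕ j) i<j)) i≮t
    found (no _) (yes _) (no t≮r) = contradiction (subst (_< r) (sym mirror²≡) (Fin.toℕ<n j)) t≮r
  toRoot-surjective (axis i) = onAxis T refl
    where
    found : ∀ c .(i<c : toℕ i < c) → r ≤ c → ¬ (toℕ i < mirror c × mirror c < r) →
            ∀ p q s → classify i c i<c p q s ≡ axis i
    found c i<c r≤c not (yes c<r) _         _         = contradiction c<r (ℕ.≤⇒≯ r≤c)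
    found c i<c r≤c not (no _)    (yes i<t) (yes t<r) = contradiction (i<t , t<r) not
    found c i<c r≤c not (no _)    (yes _)   (no _)    = refl
    found c i<c r≤c not (no _)    (no _)    _         = refl

    onAxis : ∀ T′ → T ≡ T′ → ∃ λ u → toRoot u ≡ axis i
    -- In type B column r is its own reflection, hence out of range.
    onAxis B refl = cell i r (Fin.toℕ<n i) (r≤balanced i) ,
      found r (Fin.toℕ<n i) ℕ.≤-refl
        (λ (_ , t<r) → ℕ.<-irrefl (trans (ℕ.m+n∸m≡n r (r + 0)) (ℕ.+-identityʳ r)) t<r)
        (r ℕ.<? r) (toℕ i ℕ.<? mirror r) (mirror r ℕ.<? r)
    -- In type C the root is at the end of the row, the column that reflects to i itself.
    onAxis C refl = cell i c (pos≤balanced i) ℕ.≤-refl ,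
      found c (pos≤balanced i) (r≤balanced i)
        (λ (i<t , _) → ℕ.<-irrefl (sym t≡i) i<t)
        (c ℕ.<? r) (toℕ i ℕ.<? mirror c) (mirror c ℕ.<? r)
      where
      open ≡-Reasoning
      c = balanced r i
      t≡i : mirror c ≡ toℕ i
      t≡i = begin
        2 * r ∸ 1 ∸ c         ≡⟨ ℕ.∸-+-assoc (2 * r) 1 c ⟩
        2 * r ∸ (1 + c)       ≡⟨ cong (2 * r ∸_) (ℕ.+-comm 1 c) ⟩
        2 * r ∸ (c + 1)       ≡⟨ ℕ.∸-+-assoc (2 * r) c 1 ⟨
        2 * r ∸ c ∸ 1         ≡⟨ cong (_∸ 1) (ℕ.m∸[m∸n]≡n (ℕ.≤-trans (Fin.toℕ<n i) (ℕ.m≤m+n r (r + 0)))) ⟩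
        toℕ i                 ∎

  toRoot₋ : Cell (balanced r) ₋ → PositiveRoot r ₋
  toRoot₋ ⊥₋    = ⊥₋
  toRoot₋ [ u ] = [ toRoot u ]

  open FinitePoset (Ĉ r) using (isPartialOrder) renaming (_≤_ to _⊑_)
  open IsPartialOrder isPartialOrder using (antisym; reflexive)

  toRoot₋-mono : ∀ {u v} → u ⊑ v → AugmentedRootOrder T r (toRoot₋ u) (toRoot₋ v)
  toRoot₋-mono (⊥₋≤ v)   = ⊥₋≤ toRoot₋ v
  toRoot₋-mono {[ u ]} {[ v ]} [ u≤v ] = [ toRoot-mono {u} {v} u≤v ]

  toRoot₋-cancel : ∀ {u v} → AugmentedRootOrder T r (toRoot₋ u) (toRoot₋ v) → u ⊑ v
  toRoot₋-cancel {⊥₋}    {v}     _       = ⊥₋≤ v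
  toRoot₋-cancel {[ u ]} {[ v ]} [ α≤β ] = [ toRoot-cancel {u} {v} α≤β ]

  toRoot₋-surjective : ∀ α → ∃ λ u → toRoot₋ u ≡ α
  toRoot₋-surjective ⊥₋    = ⊥₋ , refl
  toRoot₋-surjective [ α ] with toRoot-surjective α
  ... | u , refl = [ u ] , refl

  toRoot₋-isOrderIsomorphism : IsOrderIsomorphism _≡_ _≡_ _⊑_ (AugmentedRootOrder T r) toRoot₋
  toRoot₋-isOrderIsomorphism = record
    { isOrderMonomorphism = record
      { isOrderHomomorphism = record { cong = cong toRoot₋ ; mono = toRoot₋-mono }
      -- Equal images are comparable both ways, so reflecting the order gives injectivity.
      ; injective           = λ {u} {v} eq → antisym
          (toRoot₋-cancel (subst (AugmentedRootOrder T r (toRoot₋ u)) eq (toRoot₋-mono (reflexive refl))))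
          (toRoot₋-cancel (subst (AugmentedRootOrder T r (toRoot₋ v)) (sym eq) (toRoot₋-mono (reflexive refl))))
      ; cancel              = toRoot₋-cancel
      }
    ; surjective = λ α → proj₁ (toRoot₋-surjective α) ,
        λ z≡u → trans (cong toRoot₋ z≡u) (proj₂ (toRoot₋-surjective α))
    }

corollary5p4 : (∀ (m : ℕ) → let r = suc m in
    ((b : Vector ℕ r) → (∀ {i j} → i Fin.≤ j → b j ≤ b i) → (∀ i → pos i ≤ b i) →
    X b ≈ₚ y ^ₚ b₁ b
    -ₚ const (ℤ.+ r) *ₚ y ^ₚ (b₁ b ∸ 1)
    +ₚ const (ℤ.+ r ℤ.- 1ℤ) *ₚ y ^ₚ (b₁ b ∸ 2))
    ×
    ((b b′ : Vector ℕ r) →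
    (∀ {i j} → i Fin.≤ j → b j ≤ b i) → (∀ i → pos i ≤ b i) →
    (∀ {i j} → i Fin.≤ j → b′ j ≤ b′ i) → (∀ i → pos i ≤ b′ i) →
    b₁ b ≡ b₁ b′ → X b ≈ₚ X b′))
    ×
    (∀ (k : ℕ) → let r = suc (suc k) in
    (∃₂ λ _∨_ _∧_ → IsLattice _≡_ (FinitePoset._≤_ (Ĉ r)) _∨_ _∧_)
    × (∀ (T : RootType) → ∃ λ f →
    IsOrderIsomorphism _≡_ _≡_ (FinitePoset._≤_ (Ĉ r)) (AugmentedRootOrder T r) f)
    × X (balanced r) ≈ₚ
    y ^ₚ (2 * r ∸ 3) *ₚ (y -ₚ const 1ℤ) *ₚ (y -ₚ const (ℤ.+ r ℤ.- 1ℤ)))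
corollary5p4 =
  (λ m → (λ b antitone pos≤b → X-formula b antitone pos≤b) , X-cong) ,
  (λ k → let r = suc (suc k) in
    (join (balanced r) balanced-antitone , meet (balanced r) balanced-antitone ,
     F̂-isLattice (balanced r) balanced-antitone) ,
    (λ T → toRoot₋ T r , toRoot₋-isOrderIsomorphism T r) ,
    X-balanced k)
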